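{- (i) Let $S\equiv\pm\{1, 3, 4, 5, 7, 22, 23, 24, 25, 26, 27, 29\}\pmod{60}$ and $T\equiv\pm\{1, 2, 3, 7, 11, 19, 23, 24, 26, 27, 28, 29\}\pmod{60}$. Then $p(S,n)=p(T,n-1)$ for all $n\geq 1$. (ii) Let $S\equiv\pm\{2, 7, 9, 11, 12, 13, 14, 16, 17, 19, 21, 23\}\pmod{60}$ and $T\equiv\pm\{2, 5, 7, 9, 11, 12, 19, 21, 23, 25, 26, 28\}\pmod{60}$. Then $p(S,n)=p(T,n-2)$ for all $n\geq 2$. (iii) Let $S\equiv\pm\{2, 3, 5, 11, 13, 14, 16, 17, 19, 24, 25, 27\}\pmod{60}$ and $T\equiv\pm\{1, 3, 8, 11, 13, 14, 17, 19, 22, 24, 27, 29\}\pmod{60}$. Then $p(S,n)=p(T,n-2)$ for all $n\geq 2$. (iv) Let $S\equiv\pm\{1, 5, 8, 9, 12, 13, 14, 17, 21, 22, 25, 29\}\pmod{60}$ and $T\equiv\pm\{1, 4, 7, 9, 12, 13, 17, 21, 22, 23, 26, 29\}\pmod{60}$. Then $p(S,n)=p(T,n-1)$ for all $n\geq 1$.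
   Context: For a set $S$ of positive integers and an integer $n\ge 0$, $p(S,n)$ denotes the number of partitions of $n$ into parts belonging to $S$ (so $p(S,0)=1$). The notation $S\equiv\pm\{r_1,\dots,r_k\}\pmod M$ means that $S$ is the set of all positive integers $n$ such that $n\equiv r_i$ or $n\equiv -r_i\pmod M$ for some $i$. -}

module Defs where

open import Data.Nat using (ℕ; zero; suc; _+_; _∸_; _%_; _≡ᵇ_; _≤ᵇ_)
open import Data.Bool using (Bool; true; false; _∨_; _∧_; if_then_else_)
open import Data.List using (List; []; _∷_; map; _++_; filter; length)
open import Data.Bool.ListAction using (any; all)
open import Data.Nat.Properties using (≤-refl)
open import Relation.Nullary.Decidable using (Dec; yes; no)
open import Data.Bool.Properties using () renaming (_≟_ to _≟B_)
open import Relation.Binary.PropositionalEquality using (_≡_)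

-- A set S of positive integers is represented by a Boolean membership test
-- (all sets in the paper's statement are decidable: residue classes mod M).
PosSet : Set
PosSet = ℕ → Bool

pmSet : (M : ℕ) → List ℕ → PosSet
pmSet zero    rs n = false
pmSet (suc m) rs zero = false
pmSet (suc m) rs (suc k) =
  any (λ r → ((suc k) % suc m ≡ᵇ r % suc m) ∨ (((suc k) + r) % suc m ≡ᵇ 0)) rs

-- Partitions are represented as non-increasing lists of positive integers.
-- parts f k n : all non-increasing lists of positive integers, each ≤ k,
-- summing to n (f is fuel, large enough when f ≥ n).
parts : (fuel k n : ℕ) → List (List ℕ)
partsFrom : (fuel k n : ℕ) → List (List ℕ)
parts _ _ zero = [] ∷ []
parts zero _ (suc _) = []
parts (suc f) k (suc n) = partsFrom f k (suc n)
partsFrom f zero n = []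
partsFrom f (suc j) n =
  (if suc j ≤ᵇ n then map (suc j ∷_) (parts f (suc j) (n ∸ suc j)) else [])
  ++ partsFrom f j n

partitions : ℕ → List (List ℕ)
partitions n = parts n n n

p : PosSet → ℕ → ℕ
p S n = length (filter (λ λ' → all S λ' ≟B true) (partitions n))

{-# OPTIONS --safe #-}
-- Write θ(x) = (x; p)_∞ (p / x; p)_∞ with p = q^30.  By the Jacobi triple product,
-- θ(xy) θ(x/y) is, up to simple factors, the determinant g(x) h(y) − h(x) g(y) of two
-- one-variable theta series, so the Plücker relation between the 2 × 2 minors of four columns
-- (g, h) is Weierstrass' three-term relation.  For the points
--   (q^7, −q^4, −q^3, q),  (−q^11, q^9, −q^7, q^2),  (q^12, −q^4, −q^2, q),  (q^13, −q^9, −q^8, q)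
-- it becomes, after rewriting every theta product in terms of the (q^r; q^60)_∞,
-- D_T = q^s D_S + D_S D_T, where D_S = ∏_{j ∈ S} (1 − q^j); dividing by D_S D_T
-- gives ∑ p(S, n) q^n = q^s ∑ p(T, n) q^n + 1.
--
-- Everything happens in a commutative ring with q^K = 0, to be instantiated by ℤ[[q]] / (q^K):
-- there infinite products are finite products with at least K factors, and bilateral theta
-- series are finite sums.

module Submission where

open import Defs
open import Algebra.Bundles using (CommutativeRing)
open import Data.Bool using (true; false; if_then_else_; T; _∨_)
open import Data.Bool.ListAction using (all; or)
open import Data.Bool.Properties using () renaming (_≟_ to _≟B_)
open import Data.Integer as ℤ using (ℤ; +_; -[1+_]; ∣_∣)
open import Data.List using (List; []; _∷_; _++_; map; filter; length)
open import Data.List.Properties using (filter-++; length-++; map-cong)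
open import Data.List.Relation.Binary.Permutation.Propositional as ↭ using (_↭_)
open import Data.List.Relation.Unary.All using (All; []; _∷_; all?)
open import Data.Nat as ℕ using (ℕ; zero; suc; z≤n; s≤s; _∸_; _≥_)
open import Data.Nat.DivMod using ([m+kn]%n≡m%n)
open import Data.Product using (_×_; _,_; ∃)
open import Data.Sign as Sign using (Sign)
open import Level using (Level)
open import Relation.Nullary using (Dec; yes; no; contradiction)
open import Relation.Nullary.Decidable using (True; toWitness)
import Algebra.Properties.CommutativeSemiring.Exp as CommutativeSemiringExp
import Algebra.Properties.Semiring.Exp as SemiringExp
import Algebra.Solver.Ring.NaturalCoefficients.Default as NaturalSolver
import Data.Integer.Properties as ℤ
import Data.Integer.Solver as ℤSolver
import Data.Nat.Properties as ℕ
import Data.Nat.Solver as ℕSolver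
import Relation.Binary.PropositionalEquality as ≡
import Relation.Binary.Reasoning.Setoid as SetoidReasoning
open import Data.List.Sort.Base ℕ.≤-totalOrder using (module SortingAlgorithm)
open import Data.List.Sort.InsertionSort ℕ.≤-decTotalOrder using (insertionSort)
open SortingAlgorithm insertionSort using (sort; sort-↭)
open ≡ using (_≡_)

-- The modulus 60 comes from the signs of the points. A theta factor with sign - is not a product of
-- the `(q^r; q^60)_∞` but a quotient, since `(x; p)_∞ (−x; p)_∞ = (x²; p²)_∞` and `p² = q^60`. Each
-- term of the three-term relation is thus a Laurent monomial in these products. Written as
-- `Y = q^s X + Z`, the relation gives the theorem as soon as `Z / Y = D_S` and `X / Y = D_S / D_T`,
-- two equalities of finite multisets that are decided by computation. Dividing the Plücker relation
-- by the column scalings leaves the ratio of the two middle points, `± q^(b − c)`, on one term.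
-- This is the origin of `s = b − c`, and the sign decides which of the other two products stands
-- alone. The truncated ring has zero divisors, so nothing can be cancelled merely for being
-- nonzero; whatever is cancelled is a product of factors 1 + nilpotent, hence a unit. Subtraction
-- is avoided in exponents and in solver goals, which explains many rearranged statements.

-- Triangular exponents and integer indices

-- triangle n = 0 + 1 + ⋯ + (n − 1)
triangle : ℕ → ℕ
triangle zero    = 0
triangle (suc n) = n ℕ.+ triangle n

-- up j = j (j + 1) / 2 and down j = j (j − 1) / 2
up down : ℤ → ℕ
up (+ n)       = triangle (suc n)
up -[1+ n ]    = triangle (suc n)
down (+ n)     = triangle n
down -[1+ n ]  = triangle (suc (suc n))

infix 6 _⊝_
-- Data.Integer._⊖_ does not compute on successors.
_⊝_ : ℕ → ℕ → ℤ
l     ⊝ zero  = + l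
zero  ⊝ suc n = -[1+ n ]
suc l ⊝ suc n = l ⊝ n

-- `up j − up (j − 1) = j` at `j = l − n`, arranged so that everything stays in ℕ.
up-pred : ∀ l n → up (l ⊝ n) ℕ.+ n ≡ up (l ⊝ suc n) ℕ.+ l
up-pred zero    zero    = ≡.refl
up-pred zero    (suc n) = ≡.trans (ℕ.+-comm (triangle (suc n)) (suc n)) (≡.sym (ℕ.+-identityʳ _))
up-pred (suc l) zero    = ≡.trans (ℕ.+-identityʳ _) (ℕ.+-comm (suc l) (triangle (suc l)))
up-pred (suc l) (suc n) = begin
  up (l ⊝ n) ℕ.+ suc n        ≡⟨ ℕ.+-suc _ n ⟩
  suc (up (l ⊝ n) ℕ.+ n)      ≡⟨ ≡.cong suc (up-pred l n) ⟩
  suc (up (l ⊝ suc n) ℕ.+ l)  ≡⟨ ℕ.+-suc _ l ⟨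
  up (l ⊝ suc n) ℕ.+ suc l    ∎
  where open ≡.≡-Reasoning

-- Here the difference is `j − 1`, which accounts for the extra `suc` on the left.
down-pred : ∀ l n → down (l ⊝ n) ℕ.+ suc n ≡ down (l ⊝ suc n) ℕ.+ l
down-pred zero    zero    = ≡.refl
down-pred zero    (suc n) = ≡.trans (ℕ.+-comm (triangle (suc (suc n))) (suc (suc n))) (≡.sym (ℕ.+-identityʳ _))
down-pred (suc l) zero    = ≡.trans (ℕ.+-comm (triangle (suc l)) 1) (≡.trans (≡.cong suc (ℕ.+-comm l (triangle l))) (≡.sym (ℕ.+-suc _ l)))
down-pred (suc l) (suc n) = begin
  down (l ⊝ n) ℕ.+ suc (suc n)  ≡⟨ ℕ.+-suc _ (suc n) ⟩
  suc (down (l ⊝ n) ℕ.+ suc n)  ≡⟨ ≡.cong suc (down-pred l n) ⟩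
  suc (down (l ⊝ suc n) ℕ.+ l)  ≡⟨ ℕ.+-suc _ l ⟨
  down (l ⊝ suc n) ℕ.+ suc l    ∎
  where open ≡.≡-Reasoning

n≤triangle[1+n] : ∀ n → n ℕ.≤ triangle (suc n)
n≤triangle[1+n] n = ℕ.m≤m+n n (triangle n)

∣j∣≤up+down : ∀ j → ∣ j ∣ ℕ.≤ up j ℕ.+ down j
∣j∣≤up+down (+ n)     = ℕ.≤-trans (n≤triangle[1+n] n) (ℕ.m≤m+n _ _)
∣j∣≤up+down -[1+ n ]  = ℕ.≤-trans (n≤triangle[1+n] (suc n)) (ℕ.m≤n+m _ (triangle (suc n)))

∣l⊝n∣≤ : ∀ l n → n ℕ.≤ l ℕ.+ ∣ l ⊝ n ∣
∣l⊝n∣≤ l       zero    = z≤n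
∣l⊝n∣≤ zero    (suc n) = ℕ.≤-refl
∣l⊝n∣≤ (suc l) (suc n) = s≤s (∣l⊝n∣≤ l n)

∣l⊝n∣≤′ : ∀ l n → l ℕ.≤ n ℕ.+ ∣ l ⊝ n ∣
∣l⊝n∣≤′ l       zero    = ℕ.≤-refl
∣l⊝n∣≤′ zero    (suc n) = z≤n
∣l⊝n∣≤′ (suc l) (suc n) = s≤s (∣l⊝n∣≤′ l n)

-- If a double sum is grouped by `d = m + n`, the second index is `n = − m + d`; this is its value
-- at `m = s + t` on the line `d = 2 s`, and `odd-index` is the case `d = 2 s + 1`.
even-index : ∀ s t → ℤ.- (s ℤ.+ t) ℤ.+ (s ℤ.+ s) ≡ s ℤ.- t
even-index = solve 2 (λ s t → :- (s :+ t) :+ (s :+ s) := s :- t) ≡.refl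
  where open ℤSolver.+-*-Solver

odd-index : ∀ s t → ℤ.- (s ℤ.+ t) ℤ.+ (ℤ.suc (s ℤ.+ s)) ≡ ℤ.suc (s ℤ.- t)
odd-index = solve 2 (λ s t → :- (s :+ t) :+ (con (+ 1) :+ (s :+ s)) := con (+ 1) :+ (s :- t)) ≡.refl
  where open ℤSolver.+-*-Solver

shear-index : ∀ m d → d ≡ m ℤ.+ (ℤ.- m ℤ.+ d)
shear-index = solve 2 (λ m d → d := m :+ (:- m :+ d)) ≡.refl
  where open ℤSolver.+-*-Solver

-- Sums over antidiagonals and over symmetric windows

module Sums {c ℓ : Level} (R : CommutativeRing c ℓ) where
  open CommutativeRing R hiding (zero)
  open NaturalSolver commutativeSemiring using (solve; _:+_; _:=_)
  open SetoidReasoning setoid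

  antidiagonal : (ℕ → ℕ → Carrier) → ℕ → Carrier
  antidiagonal F zero    = F 0 0
  antidiagonal F (suc M) = F 0 (suc M) + antidiagonal (λ l r → F (suc l) r) M

  antidiagonal-cong : ∀ {F G : ℕ → ℕ → Carrier} M → (∀ l r → l ℕ.+ r ≡ M → F l r ≈ G l r) →
                      antidiagonal F M ≈ antidiagonal G M
  antidiagonal-cong zero    eq = eq 0 0 ≡.refl
  antidiagonal-cong (suc M) eq =
    +-cong (eq 0 (suc M) ≡.refl) (antidiagonal-cong M (λ l r p → eq (suc l) r (≡.cong suc p)))

  antidiagonal-+ : ∀ (F G : ℕ → ℕ → Carrier) M →
                   antidiagonal (λ l r → F l r + G l r) M ≈ antidiagonal F M + antidiagonal G M
  antidiagonal-+ F G zero    = refl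
  antidiagonal-+ F G (suc M) = begin
    (F 0 (suc M) + G 0 (suc M)) + antidiagonal (λ l r → F (suc l) r + G (suc l) r) M
      ≈⟨ +-congˡ (antidiagonal-+ _ _ M) ⟩
    (F 0 (suc M) + G 0 (suc M)) + (antidiagonal (λ l r → F (suc l) r) M + antidiagonal (λ l r → G (suc l) r) M)
      ≈⟨ solve 4 (λ a b c d → (a :+ b) :+ (c :+ d) := (a :+ c) :+ (b :+ d)) refl _ _ _ _ ⟩
    (F 0 (suc M) + antidiagonal (λ l r → F (suc l) r) M) + (G 0 (suc M) + antidiagonal (λ l r → G (suc l) r) M) ∎

  antidiagonal-*ˡ : ∀ x (F : ℕ → ℕ → Carrier) M →
                   x * antidiagonal F M ≈ antidiagonal (λ l r → x * F l r) M
  antidiagonal-*ˡ x F zero    = refl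
  antidiagonal-*ˡ x F (suc M) = trans (distribˡ _ _ _) (+-congˡ (antidiagonal-*ˡ x _ M))

  antidiagonal-last : ∀ (F : ℕ → ℕ → Carrier) M →
                      antidiagonal F (suc M) ≈ antidiagonal (λ l r → F l (suc r)) M + F (suc M) 0
  antidiagonal-last F zero    = refl
  antidiagonal-last F (suc M) =
    trans (+-congˡ (antidiagonal-last (λ l r → F (suc l) r) M)) (sym (+-assoc _ _ _))

  bilateral : (ℤ → Carrier) → ℕ → Carrier
  bilateral g zero    = g (+ 0)
  bilateral g (suc K) = bilateral g K + (g (+ suc K) + g -[1+ K ])

  -- The index `j = l − n` maps the pairs with `l + r = 2 n` onto the window from `− n` to `n`;
  -- raising `n` by one adds one pair at each end.
  antidiagonal-bilateral : ∀ (g : ℤ → Carrier) n →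
                           antidiagonal (λ l r → g (l ⊝ n)) (n ℕ.+ n) ≈ bilateral g n
  antidiagonal-bilateral g zero    = refl
  antidiagonal-bilateral g (suc n) = begin
    g -[1+ n ] + antidiagonal (λ l r → g (l ⊝ n)) (n ℕ.+ suc n)
      ≡⟨ ≡.cong (λ m → g -[1+ n ] + antidiagonal (λ l r → g (l ⊝ n)) m) (ℕ.+-suc n n) ⟩
    g -[1+ n ] + antidiagonal (λ l r → g (l ⊝ n)) (suc (n ℕ.+ n))
      ≈⟨ +-congˡ (antidiagonal-last (λ l r → g (l ⊝ n)) (n ℕ.+ n)) ⟩
    g -[1+ n ] + (antidiagonal (λ l r → g (l ⊝ n)) (n ℕ.+ n) + g (suc (n ℕ.+ n) ⊝ n))
      ≈⟨ +-congˡ (+-cong (antidiagonal-bilateral g n) (reflexive (≡.cong g (cancel (suc n) n)))) ⟩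
    g -[1+ n ] + (bilateral g n + g (+ suc n))
      ≈⟨ solve 3 (λ a b c → a :+ (b :+ c) := b :+ (c :+ a)) refl _ _ _ ⟩
    bilateral g n + (g (+ suc n) + g -[1+ n ]) ∎
    where
    cancel : ∀ m k → (m ℕ.+ k) ⊝ k ≡ + m
    cancel m zero    = ≡.cong +_ (ℕ.+-identityʳ m)
    cancel m (suc k) rewrite ℕ.+-suc m k = cancel m k

-- The finite triple product through Gaussian binomials

module JacobiTripleProduct {c ℓ : Level} (R : CommutativeRing c ℓ) where
  open CommutativeRing R hiding (zero)
  open Sums R
  open NaturalSolver commutativeSemiring using (solve; _:+_; _:*_; con; _:=_)
  open SemiringExp semiring using (_^_; ^-homo-*; ^-congʳ)
  open CommutativeSemiringExp commutativeSemiring using (^-distrib-*)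
  open SetoidReasoning setoid

  -- This is `(−a; p)_n`; with this sign the triple product for Ramanujan's `f(a, b)` has no signs.
  poch : Carrier → Carrier → ℕ → Carrier
  poch a p zero    = 1#
  poch a p (suc n) = poch a p n * (1# + a * p ^ n)

  -- The Gaussian binomial of `l + r` over `l`. Defined by one Pascal rule and indexed by both
  -- parts, it needs neither division nor a side condition.
  gauss : Carrier → ℕ → ℕ → Carrier
  gauss p zero    r       = 1#
  gauss p (suc l) zero    = 1#
  gauss p (suc l) (suc r) = gauss p l (suc r) + p ^ suc l * gauss p (suc l) r

  gauss-zeroʳ : ∀ p l → gauss p l 0 ≈ 1#
  gauss-zeroʳ p zero    = refl
  gauss-zeroʳ p (suc l) = refl

  -- The other Pascal rule. The symmetry in `l` and `r` is not visible in the recursion, so this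
  -- mirror image of the defining rule is proved by its own induction.
  pascal : ∀ p l r → gauss p (suc l) (suc r) ≈ gauss p (suc l) r + p ^ suc r * gauss p l (suc r)
  pascal p zero    zero    = refl
  pascal p zero    (suc r) = begin
    1# + p ^ 1 * gauss p 1 (suc r)
      ≈⟨ +-congˡ (*-congˡ (pascal p zero r)) ⟩
    1# + p ^ 1 * (gauss p 1 r + p ^ suc r * 1#)
      ≈⟨ solve 3 (λ p g x → con 1 :+ (p :* con 1) :* (g :+ x :* con 1) := (con 1 :+ (p :* con 1) :* g) :+ (p :* x) :* con 1)
           refl p (gauss p 1 r) (p ^ suc r) ⟩
    (1# + p ^ 1 * gauss p 1 r) + p ^ suc (suc r) * 1# ∎
  pascal p (suc l) zero    = begin
    gauss p (suc l) 1 + p ^ suc (suc l) * 1#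
      ≈⟨ +-congʳ (pascal p l zero) ⟩
    (1# + p ^ 1 * gauss p l 1) + p ^ suc (suc l) * 1#
      ≈⟨ solve 3 (λ p g x → (con 1 :+ (p :* con 1) :* g) :+ (p :* x) :* con 1 := con 1 :+ (p :* con 1) :* (g :+ x :* con 1))
           refl p (gauss p l 1) (p ^ suc l) ⟩
    1# + p ^ 1 * (gauss p l 1 + p ^ suc l * 1#)
      ≈⟨ +-congˡ (*-congˡ (+-congˡ (*-congˡ (sym (gauss-zeroʳ p (suc l)))))) ⟩
    1# + p ^ 1 * gauss p (suc l) 1 ∎
  pascal p (suc l) (suc r) = begin
    gauss p (suc l) (suc (suc r)) + p ^ suc (suc l) * gauss p (suc (suc l)) (suc r)
      ≈⟨ +-cong (pascal p l (suc r)) (*-congˡ (pascal p (suc l) r)) ⟩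
    (gauss p (suc l) (suc r) + p ^ suc (suc r) * gauss p l (suc (suc r)))
      + p ^ suc (suc l) * (gauss p (suc (suc l)) r + p ^ suc r * gauss p (suc l) (suc r))
      ≈⟨ solve 6 (λ p x y b c d →
             (b :+ (p :* y) :* c) :+ (p :* x) :* (d :+ y :* b)
             := (b :+ (p :* x) :* d) :+ (p :* y) :* (c :+ x :* b))
           refl p (p ^ suc l) (p ^ suc r) (gauss p (suc l) (suc r)) (gauss p l (suc (suc r))) (gauss p (suc (suc l)) r) ⟩
    (gauss p (suc l) (suc r) + p ^ suc (suc l) * gauss p (suc (suc l)) r)
      + p ^ suc (suc r) * (gauss p l (suc (suc r)) + p ^ suc l * gauss p (suc l) (suc r)) ∎

  -- `poch (- p) p n` is `(p; p)_n`, so this is the quotient formula for the Gaussian binomial,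
  -- multiplied out.
  poch-gauss : ∀ p l r → poch (- p) p l * poch (- p) p r * gauss p l r ≈ poch (- p) p (l ℕ.+ r)
  poch-gauss p zero    r       = solve 1 (λ x → con 1 :* x :* con 1 := x) refl _
  poch-gauss p (suc l) zero    = begin
    poch (- p) p (suc l) * 1# * 1#  ≈⟨ solve 1 (λ x → x :* con 1 :* con 1 := x) refl _ ⟩
    poch (- p) p (suc l)            ≡⟨ ≡.cong (poch (- p) p) (ℕ.+-identityʳ (suc l)) ⟨
    poch (- p) p (suc l ℕ.+ 0)      ∎
  poch-gauss p (suc l) (suc r) = begin
    pl * u * (pr * v) * (x + p * y * z)
      ≈⟨ solve 8 (λ pl u pr v x p y z →
           pl :* u :* (pr :* v) :* (x :+ p :* y :* z)
           := u :* (pl :* (pr :* v) :* x) :+ p :* y :* v :* (pl :* u :* pr :* z)) refl pl u pr v x p y z ⟩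
    u * (pl * (pr * v) * x) + p * y * v * (pl * u * pr * z)
      ≈⟨ +-cong (*-congˡ (trans (poch-gauss p l (suc r)) (reflexive (≡.cong (poch (- p) p) (ℕ.+-suc l r)))))
                (*-congˡ (poch-gauss p (suc l) r)) ⟩
    (1# + n * y) * pn + p * y * (1# + n * w) * pn
      ≈⟨ solve 5 (λ p n y w pn → (con 1 :+ n :* y) :* pn :+ p :* y :* (con 1 :+ n :* w) :* pn
           := pn :* (con 1 :+ n :* (p :* (y :* w))) :+ (p :+ n) :* (y :* pn)) refl p n y w pn ⟩
    pn * (1# + n * (p * (y * w))) + (p + n) * (y * pn)
      ≈⟨ +-cong (*-congˡ (+-congˡ (*-congˡ (*-congˡ (sym (^-homo-* p l r)))))) (*-congʳ (-‿inverseʳ p)) ⟩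
    pn * (1# + n * (p * p ^ (l ℕ.+ r))) + 0# * (y * pn)
      ≈⟨ trans (+-congˡ (zeroˡ _)) (+-identityʳ _) ⟩
    pn * (1# + n * p ^ suc (l ℕ.+ r))
      ≡⟨ ≡.cong (poch (- p) p) (≡.cong suc (ℕ.+-suc l r)) ⟨
    poch (- p) p (suc l ℕ.+ suc r) ∎
    where
    n = - p
    pl = poch n p l
    pr = poch n p r
    pn = poch n p (suc (l ℕ.+ r))
    y = p ^ l
    w = p ^ r
    u = 1# + n * y
    v = 1# + n * w
    x = gauss p l (suc r)
    z = gauss p (suc l) r

  -- Each `V (suc l)` receives contributions from two neighbouring pairs, and `pascal` merges their
  -- coefficients. In `gauss-stepˡ` the defining recursion of `gauss` plays that role.
  gauss-stepʳ : ∀ p (V : ℕ → Carrier) M →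
    antidiagonal (λ l r → gauss p l r * (V l + p ^ r * V (suc l))) M
    ≈ antidiagonal (λ l r → gauss p l r * V l) (suc M)
  gauss-stepʳ p V zero    = solve 2 (λ v w → con 1 :* (v :+ con 1 :* w) := con 1 :* v :+ con 1 :* w) refl _ _
  gauss-stepʳ p V (suc M) = begin
    antidiagonal (λ l r → gauss p l r * (V l + p ^ r * V (suc l))) (suc M)
      ≈⟨ antidiagonal-cong (suc M) (λ l r _ → distribˡ (gauss p l r) (V l) (p ^ r * V (suc l))) ⟩
    antidiagonal (λ l r → F l r + G l r) (suc M)
      ≈⟨ antidiagonal-+ F G (suc M) ⟩
    antidiagonal F (suc M) + antidiagonal G (suc M)
      ≈⟨ +-congˡ (antidiagonal-last G M) ⟩
    (1# * V 0 + antidiagonal (λ l r → F (suc l) r) M) + (antidiagonal (λ l r → G l (suc r)) M + G (suc M) 0)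
      ≈⟨ solve 4 (λ a b c d → (a :+ b) :+ (c :+ d) := a :+ ((b :+ c) :+ d)) refl _ _ _ _ ⟩
    1# * V 0 + ((antidiagonal (λ l r → F (suc l) r) M + antidiagonal (λ l r → G l (suc r)) M) + G (suc M) 0)
      ≈⟨ +-congˡ (+-cong (sym (antidiagonal-+ _ _ M)) (*-congˡ (*-identityˡ _))) ⟩
    1# * V 0 + (antidiagonal (λ l r → F (suc l) r + G l (suc r)) M + H (suc M) 0)
      ≈⟨ +-congˡ (+-congʳ (antidiagonal-cong M (λ l r _ → step l r))) ⟩
    1# * V 0 + (antidiagonal (λ l r → H l (suc r)) M + H (suc M) 0)
      ≈⟨ +-congˡ (sym (antidiagonal-last H M)) ⟩
    1# * V 0 + antidiagonal H (suc M) ∎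
    where
    F G H : ℕ → ℕ → Carrier
    F l r = gauss p l r * V l
    G l r = gauss p l r * (p ^ r * V (suc l))
    H l r = gauss p (suc l) r * V (suc l)
    step : ∀ l r → F (suc l) r + G l (suc r) ≈ H l (suc r)
    step l r = begin
      gauss p (suc l) r * V (suc l) + gauss p l (suc r) * (p ^ suc r * V (suc l))
        ≈⟨ solve 4 (λ a b c v → a :* v :+ b :* (c :* v) := (a :+ c :* b) :* v) refl _ _ _ _ ⟩
      (gauss p (suc l) r + p ^ suc r * gauss p l (suc r)) * V (suc l)
        ≈⟨ *-congʳ (sym (pascal p l r)) ⟩
      gauss p (suc l) (suc r) * V (suc l) ∎

  gauss-stepˡ : ∀ p (V : ℕ → Carrier) M →
    antidiagonal (λ l r → gauss p l r * (V (suc l) + p ^ l * V l)) M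
    ≈ antidiagonal (λ l r → gauss p l r * V l) (suc M)
  gauss-stepˡ p V zero    = solve 2 (λ v w → con 1 :* (v :+ con 1 :* w) := con 1 :* w :+ con 1 :* v) refl _ _
  gauss-stepˡ p V (suc M) = begin
    antidiagonal (λ l r → gauss p l r * (V (suc l) + p ^ l * V l)) (suc M)
      ≈⟨ antidiagonal-cong (suc M) (λ l r _ → distribˡ (gauss p l r) (V (suc l)) (p ^ l * V l)) ⟩
    antidiagonal (λ l r → F l r + G l r) (suc M)
      ≈⟨ antidiagonal-+ F G (suc M) ⟩
    antidiagonal F (suc M) + antidiagonal G (suc M)
      ≈⟨ +-congʳ (antidiagonal-last F M) ⟩
    (antidiagonal (λ l r → F l (suc r)) M + F (suc M) 0) + (1# * (1# * V 0) + antidiagonal (λ l r → G (suc l) r) M)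
      ≈⟨ solve 4 (λ a b c d → (a :+ b) :+ (con 1 :* (con 1 :* c) :+ d) := (con 1 :* c :+ (a :+ d)) :+ b) refl _ _ _ _ ⟩
    (H 0 (suc M) + (antidiagonal (λ l r → F l (suc r)) M + antidiagonal (λ l r → G (suc l) r) M)) + F (suc M) 0
      ≈⟨ +-congʳ (+-congˡ (sym (antidiagonal-+ _ _ M))) ⟩
    (H 0 (suc M) + antidiagonal (λ l r → F l (suc r) + G (suc l) r) M) + F (suc M) 0
      ≈⟨ +-congʳ (+-congˡ (antidiagonal-cong M (λ l r _ → step l r))) ⟩
    (H 0 (suc M) + antidiagonal (λ l r → H (suc l) r) M) + F (suc M) 0
      ≈⟨ sym (antidiagonal-last (λ l r → gauss p l r * V l) (suc M)) ⟩
    antidiagonal (λ l r → gauss p l r * V l) (suc (suc M)) ∎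
    where
    F G H : ℕ → ℕ → Carrier
    F l r = gauss p l r * V (suc l)
    G l r = gauss p l r * (p ^ l * V l)
    H l r = gauss p l (suc r) * V l
    step : ∀ l r → F l (suc r) + G (suc l) r ≈ H (suc l) r
    step l r = solve 4 (λ a b c v → a :* v :+ b :* (c :* v) := (a :+ c :* b) :* v) refl _ _ _ _

  -- The general term of Ramanujan's f(a, b).
  term : Carrier → Carrier → ℤ → Carrier
  term a b j = a ^ up j * b ^ down j

  module _ (a b : Carrier) where
    private
      ab = a * b

    collect : ∀ u d n m → a ^ u * b ^ d * (a ^ n * b ^ m) ≈ a ^ (u ℕ.+ n) * b ^ (d ℕ.+ m)
    collect u d n m = begin
      a ^ u * b ^ d * (a ^ n * b ^ m)
        ≈⟨ solve 4 (λ x y z w → x :* y :* (z :* w) := x :* z :* (y :* w)) refl _ _ _ _ ⟩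
      a ^ u * a ^ n * (b ^ d * b ^ m)
        ≈⟨ *-cong (sym (^-homo-* a u n)) (sym (^-homo-* b d m)) ⟩
      a ^ (u ℕ.+ n) * b ^ (d ℕ.+ m) ∎

    -- The ratio of `term` at `j − 1` to `term` at `j` is `b (ab)^(− j)`; at `j = l − n` the factor
    -- `ab ^ l` removes the negative powers.
    term-stepˡ : ∀ l n → term a b (l ⊝ n) * (b * ab ^ n) ≈ ab ^ l * term a b (l ⊝ suc n)
    term-stepˡ l n = begin
      term a b (l ⊝ n) * (b * ab ^ n)
        ≈⟨ *-congˡ (*-congˡ (^-distrib-* a b n)) ⟩
      term a b (l ⊝ n) * (b * (a ^ n * b ^ n))
        ≈⟨ *-congˡ (solve 3 (λ x y z → x :* (y :* z) := y :* (x :* z)) refl _ _ _) ⟩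
      term a b (l ⊝ n) * (a ^ n * b ^ suc n)
        ≈⟨ collect (up (l ⊝ n)) (down (l ⊝ n)) n (suc n) ⟩
      a ^ (up (l ⊝ n) ℕ.+ n) * b ^ (down (l ⊝ n) ℕ.+ suc n)
        ≈⟨ *-cong (^-congʳ a (up-pred l n)) (^-congʳ b (down-pred l n)) ⟩
      a ^ (up (l ⊝ suc n) ℕ.+ l) * b ^ (down (l ⊝ suc n) ℕ.+ l)
        ≈⟨ collect (up (l ⊝ suc n)) (down (l ⊝ suc n)) l l ⟨
      term a b (l ⊝ suc n) * (a ^ l * b ^ l)
        ≈⟨ *-congˡ (^-distrib-* a b l) ⟨
      term a b (l ⊝ suc n) * ab ^ l
        ≈⟨ *-comm _ _ ⟩
      ab ^ l * term a b (l ⊝ suc n) ∎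

    -- The ratio of `term` at `j + 1` to `term` at `j` is `a (ab)^j`, and `j + r = n` on the
    -- antidiagonal `l + r = 2 n`.
    term-stepʳ : ∀ l r n → l ℕ.+ r ≡ n ℕ.+ n → term a b (l ⊝ n) * (a * ab ^ n) ≈ ab ^ r * term a b (suc l ⊝ n)
    term-stepʳ l r n eq = begin
      term a b (l ⊝ n) * (a * ab ^ n)
        ≈⟨ *-congˡ (*-congˡ (^-distrib-* a b n)) ⟩
      term a b (l ⊝ n) * (a * (a ^ n * b ^ n))
        ≈⟨ *-congˡ (sym (*-assoc _ _ _)) ⟩
      term a b (l ⊝ n) * (a ^ suc n * b ^ n)
        ≈⟨ collect (up (l ⊝ n)) (down (l ⊝ n)) (suc n) n ⟩
      a ^ (up (l ⊝ n) ℕ.+ suc n) * b ^ (down (l ⊝ n) ℕ.+ n)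
        ≈⟨ *-cong (^-congʳ a up-succ) (^-congʳ b down-succ) ⟩
      a ^ (up (suc l ⊝ n) ℕ.+ r) * b ^ (down (suc l ⊝ n) ℕ.+ r)
        ≈⟨ collect (up (suc l ⊝ n)) (down (suc l ⊝ n)) r r ⟨
      term a b (suc l ⊝ n) * (a ^ r * b ^ r)
        ≈⟨ *-congˡ (^-distrib-* a b r) ⟨
      term a b (suc l ⊝ n) * ab ^ r
        ≈⟨ *-comm _ _ ⟩
      ab ^ r * term a b (suc l ⊝ n) ∎
      where
      module ℕR = ≡.≡-Reasoning
      shuffle : ∀ x → x ℕ.+ n ℕ.+ n ≡ x ℕ.+ l ℕ.+ r
      shuffle x = ≡.trans (ℕ.+-assoc x n n) (≡.trans (≡.cong (x ℕ.+_) (≡.sym eq)) (≡.sym (ℕ.+-assoc x l r)))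
      swap : ∀ x y z → x ℕ.+ y ℕ.+ z ≡ x ℕ.+ z ℕ.+ y
      swap x y z = ≡.trans (ℕ.+-assoc x y z) (≡.trans (≡.cong (x ℕ.+_) (ℕ.+-comm y z)) (≡.sym (ℕ.+-assoc x z y)))
      up-succ : up (l ⊝ n) ℕ.+ suc n ≡ up (suc l ⊝ n) ℕ.+ r
      up-succ = ℕ.+-cancelʳ-≡ n _ _ (ℕR.begin
        up (l ⊝ n) ℕ.+ suc n ℕ.+ n        ℕR.≡⟨ ≡.cong (ℕ._+ n) (ℕ.+-suc _ n) ⟩
        suc (up (l ⊝ n) ℕ.+ n ℕ.+ n)      ℕR.≡⟨ ≡.cong suc (shuffle (up (l ⊝ n))) ⟩
        suc (up (l ⊝ n) ℕ.+ l) ℕ.+ r      ℕR.≡⟨ ≡.cong (ℕ._+ r) (ℕ.+-suc _ l) ⟨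
        -- `suc l ⊝ suc n` reduces to `l ⊝ n`, so the rule for predecessors, read backwards at
        -- `suc l`, moves the index up.
        up (l ⊝ n) ℕ.+ suc l ℕ.+ r        ℕR.≡⟨ ≡.cong (ℕ._+ r) (up-pred (suc l) n) ⟨
        up (suc l ⊝ n) ℕ.+ n ℕ.+ r        ℕR.≡⟨ swap _ n r ⟩
        up (suc l ⊝ n) ℕ.+ r ℕ.+ n        ℕR.∎)
      down-succ : down (l ⊝ n) ℕ.+ n ≡ down (suc l ⊝ n) ℕ.+ r
      down-succ = ℕ.+-cancelʳ-≡ (suc n) _ _ (ℕR.begin
        down (l ⊝ n) ℕ.+ n ℕ.+ suc n      ℕR.≡⟨ ℕ.+-suc _ n ⟩
        suc (down (l ⊝ n) ℕ.+ n ℕ.+ n)    ℕR.≡⟨ ≡.cong suc (shuffle (down (l ⊝ n))) ⟩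
        suc (down (l ⊝ n) ℕ.+ l) ℕ.+ r    ℕR.≡⟨ ≡.cong (ℕ._+ r) (ℕ.+-suc _ l) ⟨
        down (l ⊝ n) ℕ.+ suc l ℕ.+ r      ℕR.≡⟨ ≡.cong (ℕ._+ r) (down-pred (suc l) n) ⟨
        down (suc l ⊝ n) ℕ.+ suc n ℕ.+ r  ℕR.≡⟨ swap _ (suc n) r ⟩
        down (suc l ⊝ n) ℕ.+ r ℕ.+ suc n  ℕR.∎)

    -- By induction, two factors at a time: `1 + a (ab)^n` carries the sum from antidiagonal `2 n`
    -- to `2 n + 1`, and `1 + b (ab)^n` carries it to `2 n + 2`.
    finite-triple-product : ∀ n →
      poch a ab n * poch b ab n ≈ antidiagonal (λ l r → gauss ab l r * term a b (l ⊝ n)) (n ℕ.+ n)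
    finite-triple-product zero    = solve 0 (con 1 :* con 1 := con 1 :* (con 1 :* con 1)) refl
    finite-triple-product (suc n) = begin
      poch a ab (suc n) * poch b ab (suc n)
        ≈⟨ solve 4 (λ x y z w → x :* y :* (z :* w) := (x :* z :* y) :* w) refl _ _ _ _ ⟩
      poch a ab n * poch b ab n * (1# + a * ab ^ n) * (1# + b * ab ^ n)
        ≈⟨ *-congʳ (multiply (a * ab ^ n) (λ l r → ab ^ r * term a b (suc l ⊝ n)) (n ℕ.+ n) (finite-triple-product n) (λ l r → term-stepʳ l r n)) ⟩
      antidiagonal (λ l r → gauss ab l r * (term a b (l ⊝ n) + ab ^ r * term a b (suc l ⊝ n))) (n ℕ.+ n) * (1# + b * ab ^ n)
        -- Between the two factors the sum is recentred: `l ⊝ n` is read as `suc l ⊝ suc n`, which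
        -- makes it the `V (suc l)` of `gauss-stepˡ`.
        ≈⟨ multiply (b * ab ^ n) (λ l r → ab ^ l * term a b (l ⊝ suc n)) (suc (n ℕ.+ n)) (gauss-stepʳ ab (λ l → term a b (l ⊝ n)) (n ℕ.+ n)) (λ l r _ → term-stepˡ l n) ⟩
      antidiagonal (λ l r → gauss ab l r * (term a b (suc l ⊝ suc n) + ab ^ l * term a b (l ⊝ suc n))) (suc (n ℕ.+ n))
        ≈⟨ gauss-stepˡ ab (λ l → term a b (l ⊝ suc n)) (suc (n ℕ.+ n)) ⟩
      antidiagonal (λ l r → gauss ab l r * term a b (l ⊝ suc n)) (suc (suc (n ℕ.+ n)))
        ≡⟨ ≡.cong (λ m → antidiagonal (λ l r → gauss ab l r * term a b (l ⊝ suc n)) (suc m)) (ℕ.+-suc n n) ⟨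
      antidiagonal (λ l r → gauss ab l r * term a b (l ⊝ suc n)) (suc n ℕ.+ suc n) ∎
      where
      multiply : ∀ {y} x (F : ℕ → ℕ → Carrier) M →
                 y ≈ antidiagonal (λ l r → gauss ab l r * term a b (l ⊝ n)) M →
                 (∀ l r → l ℕ.+ r ≡ M → term a b (l ⊝ n) * x ≈ F l r) →
                 y * (1# + x) ≈ antidiagonal (λ l r → gauss ab l r * (term a b (l ⊝ n) + F l r)) M
      multiply {y} x F M y≈ step = begin
        y * (1# + x)
          ≈⟨ trans (*-comm _ _) (*-congˡ y≈) ⟩
        (1# + x) * antidiagonal (λ l r → gauss ab l r * term a b (l ⊝ n)) M
          ≈⟨ antidiagonal-*ˡ _ _ M ⟩
        antidiagonal (λ l r → (1# + x) * (gauss ab l r * term a b (l ⊝ n))) M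
          ≈⟨ antidiagonal-cong M (λ l r l+r≡M → trans
               (solve 3 (λ x g t → (con 1 :+ x) :* (g :* t) := g :* (t :+ t :* x)) refl x _ _)
               (*-congˡ (+-congˡ (step l r l+r≡M)))) ⟩
        antidiagonal (λ l r → gauss ab l r * (term a b (l ⊝ n) + F l r)) M ∎

-- Units, stable products and the triple product when q is nilpotent

module Nilpotent {c ℓ : Level} (R : CommutativeRing c ℓ) (K : ℕ) where
  open CommutativeRing R hiding (zero)
  open Sums R
  open JacobiTripleProduct R
  open NaturalSolver commutativeSemiring using (solve; _:+_; _:*_; con; _:=_)
  open SemiringExp semiring using (_^_; ^-homo-*; ^-congˡ)
  open CommutativeSemiringExp commutativeSemiring using (^-distrib-*)
  open SetoidReasoning setoid

  Invertible : Carrier → Set _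
  Invertible x = ∃ λ y → x * y ≈ 1#

  invertible-* : ∀ {x y} → Invertible x → Invertible y → Invertible (x * y)
  invertible-* {x} {y} (u , xu≈1) (v , yv≈1) = u * v , (begin
    x * y * (u * v)  ≈⟨ solve 4 (λ x y u v → x :* y :* (u :* v) := x :* u :* (y :* v)) refl x y u v ⟩
    x * u * (y * v)  ≈⟨ *-cong xu≈1 yv≈1 ⟩
    1# * 1#          ≈⟨ *-identityˡ 1# ⟩
    1#               ∎)

  invertible-cancel : ∀ {x y z} → Invertible x → x * y ≈ x * z → y ≈ z
  invertible-cancel {x} {y} {z} (u , xu≈1) xy≈xz = begin
    y            ≈⟨ step y ⟨
    u * (x * y)  ≈⟨ *-congˡ xy≈xz ⟩
    u * (x * z)  ≈⟨ step z ⟩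
    z            ∎
    where
    step : ∀ w → u * (x * w) ≈ w
    step w = begin
      u * (x * w)  ≈⟨ solve 3 (λ u x w → u :* (x :* w) := x :* u :* w) refl u x w ⟩
      x * u * w    ≈⟨ *-congʳ xu≈1 ⟩
      1# * w       ≈⟨ *-identityˡ w ⟩
      w            ∎

  ^-vanish : ∀ {x n} → x ^ K ≈ 0# → K ℕ.≤ n → x ^ n ≈ 0#
  ^-vanish {x} {n} x^K≈0 K≤n = begin
    x ^ n                    ≡⟨ ≡.cong (x ^_) (ℕ.m+[n∸m]≡n K≤n) ⟨
    x ^ (K ℕ.+ (n ℕ.∸ K))    ≈⟨ ^-homo-* x K (n ℕ.∸ K) ⟩
    x ^ K * x ^ (n ℕ.∸ K)    ≈⟨ *-congʳ x^K≈0 ⟩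
    0# * x ^ (n ℕ.∸ K)       ≈⟨ zeroˡ _ ⟩
    0#                       ∎

  *-nilpotentˡ : ∀ {x} y → x ^ K ≈ 0# → (x * y) ^ K ≈ 0#
  *-nilpotentˡ {x} y x^K≈0 = trans (^-distrib-* x y K) (trans (*-congʳ x^K≈0) (zeroˡ _))

  *-nilpotentʳ : ∀ {x} y → x ^ K ≈ 0# → (y * x) ^ K ≈ 0#
  *-nilpotentʳ {x} y x^K≈0 = trans (^-distrib-* y x K) (trans (*-congˡ x^K≈0) (zeroʳ _))

  -- The geometric series in `−x` stops after `K` terms.
  1+nilpotent-invertible : ∀ {x} → x ^ K ≈ 0# → Invertible (1# + x)
  1+nilpotent-invertible {x} x^K≈0 = geometric K , (begin
    (1# + x) * geometric K
      ≈⟨ +-identityʳ _ ⟨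
    (1# + x) * geometric K + 0#
      ≈⟨ +-congˡ (trans (^-distrib-* (- 1#) x K) (trans (*-congˡ x^K≈0) (zeroʳ _))) ⟨
    (1# + x) * geometric K + (- 1# * x) ^ K
      ≈⟨ telescope K ⟩
    1# ∎)
    where
    geometric : ℕ → Carrier
    geometric zero    = 0#
    geometric (suc n) = geometric n + (- 1# * x) ^ n
    telescope : ∀ n → (1# + x) * geometric n + (- 1# * x) ^ n ≈ 1#
    telescope zero    = trans (+-congʳ (zeroʳ _)) (+-identityˡ _)
    telescope (suc n) = begin
      (1# + x) * (geometric n + (- 1# * x) ^ n) + - 1# * x * (- 1# * x) ^ n
        ≈⟨ solve 4 (λ x g y m → (con 1 :+ x) :* (g :+ y) :+ m :* x :* y
             := ((con 1 :+ x) :* g :+ y) :+ (con 1 :+ m) :* (x :* y)) refl x (geometric n) _ (- 1#) ⟩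
      ((1# + x) * geometric n + (- 1# * x) ^ n) + (1# + - 1#) * (x * (- 1# * x) ^ n)
        ≈⟨ +-cong (telescope n) (trans (*-congʳ (-‿inverseʳ 1#)) (zeroˡ _)) ⟩
      1# + 0#
        ≈⟨ +-identityʳ 1# ⟩
      1# ∎

  poch-cong : ∀ {a a′ p p′} n → a ≈ a′ → p ≈ p′ → poch a p n ≈ poch a′ p′ n
  poch-cong zero    a≈ p≈ = refl
  poch-cong (suc n) a≈ p≈ = *-cong (poch-cong n a≈ p≈) (+-congˡ (*-cong a≈ (^-congˡ n p≈)))

  poch-invertible : ∀ {a} p n → a ^ K ≈ 0# → Invertible (poch a p n)
  poch-invertible p zero    a^K≈0 = 1# , *-identityˡ 1#
  poch-invertible p (suc n) a^K≈0 =
    invertible-* (poch-invertible p n a^K≈0) (1+nilpotent-invertible (*-nilpotentˡ _ a^K≈0))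

  -- From index `K` on every factor is 1, so any partial product with at least `K` factors
  -- represents the infinite product.
  poch-stable : ∀ a {p n} → p ^ K ≈ 0# → K ℕ.≤ n → poch a p n ≈ poch a p K
  poch-stable a {p} {n} p^K≈0 K≤n = go (ℕ.≤⇒≤′ K≤n)
    where
    go : ∀ {m} → K ℕ.≤′ m → poch a p m ≈ poch a p K
    go (ℕ.≤′-reflexive ≡.refl)   = refl
    go (ℕ.≤′-step {m} K≤′m) = begin
      poch a p m * (1# + a * p ^ m)  ≈⟨ *-cong (go K≤′m) (+-congˡ (*-congˡ (^-vanish p^K≈0 (ℕ.≤′⇒≤ K≤′m)))) ⟩
      poch a p K * (1# + a * 0#)     ≈⟨ *-congˡ (trans (+-congˡ (zeroʳ a)) (+-identityʳ 1#)) ⟩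
      poch a p K * 1#                ≈⟨ *-identityʳ _ ⟩
      poch a p K                     ∎

  -- For `j ≥ 0` the exponent of `a` is at least `∣ j ∣`; for `j < 0` that of `b` is.
  term-vanish : ∀ {a b} → a ^ K ≈ 0# → b ^ K ≈ 0# → ∀ j → K ℕ.≤ ∣ j ∣ → term a b j ≈ 0#
  term-vanish a^K≈0 b^K≈0 (+ n)    K≤n = trans (*-congʳ (^-vanish a^K≈0 (ℕ.≤-trans K≤n (n≤triangle[1+n] n)))) (zeroˡ _)
  term-vanish a^K≈0 b^K≈0 -[1+ n ] K≤n = trans (*-congˡ (^-vanish b^K≈0 (ℕ.≤-trans K≤n (n≤triangle[1+n] (suc n))))) (zeroʳ _)

  -- The limit of the finite form: `(ab; ab)_∞` turns each Gaussian binomial into 1 wherever `term`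
  -- does not vanish. The bound `2 K` leaves room for this on both sides of the centre.
  triple-product : ∀ {a b} n → a ^ K ≈ 0# → b ^ K ≈ 0# → K ℕ.+ K ℕ.≤ n →
    poch (- (a * b)) (a * b) n * (poch a (a * b) n * poch b (a * b) n) ≈ bilateral (term a b) n
  triple-product {a} {b} n a^K≈0 b^K≈0 2K≤n = begin
    e * (poch a ab n * poch b ab n)
      ≈⟨ *-congˡ (finite-triple-product a b n) ⟩
    e * antidiagonal (λ l r → gauss ab l r * term a b (l ⊝ n)) (n ℕ.+ n)
      ≈⟨ antidiagonal-*ˡ _ _ (n ℕ.+ n) ⟩
    antidiagonal (λ l r → e * (gauss ab l r * term a b (l ⊝ n))) (n ℕ.+ n)
      ≈⟨ antidiagonal-cong (n ℕ.+ n) limit ⟩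
    antidiagonal (λ l r → term a b (l ⊝ n)) (n ℕ.+ n)
      ≈⟨ antidiagonal-bilateral (term a b) n ⟩
    bilateral (term a b) n ∎
    where
    ab = a * b
    e = poch (- ab) ab n
    ab^K≈0 : ab ^ K ≈ 0#
    ab^K≈0 = *-nilpotentˡ b a^K≈0
    stable : ∀ {m} → K ℕ.≤ m → poch (- ab) ab m ≈ e
    stable K≤m = trans (poch-stable _ ab^K≈0 K≤m)
                       (sym (poch-stable _ ab^K≈0 (ℕ.≤-trans (ℕ.m≤m+n K K) 2K≤n)))
    -ab^K≈0 : (- ab) ^ K ≈ 0#
    -ab^K≈0 = trans (^-congˡ K (sym (trans (*-comm _ _) (-1*x≈-x ab)))) (*-nilpotentˡ (- 1#) ab^K≈0)
      where open import Algebra.Properties.Ring ring using (-1*x≈-x)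
    limit : ∀ l r → l ℕ.+ r ≡ n ℕ.+ n → e * (gauss ab l r * term a b (l ⊝ n)) ≈ term a b (l ⊝ n)
    -- If `∣ l − n ∣ ≥ K` the term is zero. Otherwise `n ≥ 2 K` forces `l ≥ K` and `r ≥ K`, so all
    -- products in `poch-gauss` have stabilised to `e`; it reads `e e gauss = e`, and the unit `e`
    -- cancels.
    limit l r l+r≡2n with K ℕ.≤? ∣ l ⊝ n ∣
    ... | yes K≤ = trans (*-congˡ (trans (*-congˡ T≈0) (zeroʳ _))) (trans (zeroʳ _) (sym T≈0))
      where T≈0 = term-vanish a^K≈0 b^K≈0 (l ⊝ n) K≤
    ... | no K≰ = begin
      e * (gauss ab l r * term a b (l ⊝ n))
        ≈⟨ *-assoc _ _ _ ⟨
      e * gauss ab l r * term a b (l ⊝ n)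
        ≈⟨ *-congʳ (invertible-cancel (poch-invertible ab n -ab^K≈0) eeg≈e) ⟩
      1# * term a b (l ⊝ n)
        ≈⟨ *-identityˡ _ ⟩
      term a b (l ⊝ n) ∎
      where
      ∣j∣≤K : ∣ l ⊝ n ∣ ℕ.≤ K
      ∣j∣≤K = ℕ.<⇒≤ (ℕ.≰⇒> K≰)
      K≤l : K ℕ.≤ l
      K≤l = ℕ.+-cancelʳ-≤ K K l (ℕ.≤-trans 2K≤n (ℕ.≤-trans (∣l⊝n∣≤ l n) (ℕ.+-monoʳ-≤ l ∣j∣≤K)))
      K≤r : K ℕ.≤ r
      K≤r = ℕ.+-cancelˡ-≤ K K r (ℕ.≤-trans 2K≤n (ℕ.+-cancelˡ-≤ n n (K ℕ.+ r)
        (ℕ.≤-trans (ℕ.≤-reflexive (≡.sym l+r≡2n))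
        (ℕ.≤-trans (ℕ.+-monoˡ-≤ r (ℕ.≤-trans (∣l⊝n∣≤′ l n) (ℕ.+-monoʳ-≤ n ∣j∣≤K)))
                   (ℕ.≤-reflexive (ℕ.+-assoc n K r))))))
      eeg≈e : e * (e * gauss ab l r) ≈ e * 1#
      eeg≈e = begin
        e * (e * gauss ab l r)
          ≈⟨ *-assoc _ _ _ ⟨
        e * e * gauss ab l r
          ≈⟨ *-congʳ (*-cong (sym (stable K≤l)) (sym (stable K≤r))) ⟩
        poch (- ab) ab l * poch (- ab) ab r * gauss ab l r
          ≈⟨ poch-gauss ab l r ⟩
        poch (- ab) ab (l ℕ.+ r)
          ≈⟨ stable (ℕ.≤-trans K≤l (ℕ.m≤m+n l r)) ⟩
        e
          ≈⟨ *-identityʳ e ⟨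
        e * 1# ∎

-- Rearranging finitely supported bilateral sums

module BilateralSums {c ℓ : Level} (R : CommutativeRing c ℓ) (K : ℕ) where
  open CommutativeRing R hiding (zero)
  open Sums R
  open NaturalSolver commutativeSemiring using (solve; _:+_; _:*_; con; _:=_)
  open SetoidReasoning setoid

  Supported : ℕ → (ℤ → Carrier) → Set _
  Supported M g = ∀ j → M ℕ.≤ ∣ j ∣ → g j ≈ 0#

  bilateral-cong : ∀ {g h : ℤ → Carrier} L → (∀ j → g j ≈ h j) → bilateral g L ≈ bilateral h L
  bilateral-cong zero    eq = eq (+ 0)
  bilateral-cong (suc L) eq = +-cong (bilateral-cong L eq) (+-cong (eq _) (eq _))

  bilateral-zero : ∀ {g : ℤ → Carrier} L → (∀ j → g j ≈ 0#) → bilateral g L ≈ 0#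
  bilateral-zero zero    eq = eq (+ 0)
  bilateral-zero (suc L) eq =
    trans (+-cong (bilateral-zero L eq) (trans (+-cong (eq _) (eq _)) (+-identityˡ 0#))) (+-identityˡ 0#)

  bilateral-+ : ∀ (g h : ℤ → Carrier) L → bilateral (λ j → g j + h j) L ≈ bilateral g L + bilateral h L
  bilateral-+ g h zero    = refl
  bilateral-+ g h (suc L) = trans (+-congʳ (bilateral-+ g h L))
    (solve 6 (λ a b c d e f → (a :+ b) :+ ((c :+ d) :+ (e :+ f)) := (a :+ (c :+ e)) :+ (b :+ (d :+ f))) refl _ _ _ _ _ _)

  bilateral-*ˡ : ∀ x (g : ℤ → Carrier) L → bilateral (λ j → x * g j) L ≈ x * bilateral g L
  bilateral-*ˡ x g zero    = refl
  bilateral-*ˡ x g (suc L) = trans (+-cong (bilateral-*ˡ x g L) (sym (distribˡ _ _ _))) (sym (distribˡ _ _ _))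

  bilateral-*ʳ : ∀ x (g : ℤ → Carrier) L → bilateral (λ j → g j * x) L ≈ bilateral g L * x
  bilateral-*ʳ x g L = trans (bilateral-cong L (λ j → *-comm (g j) x)) (trans (bilateral-*ˡ x g L) (*-comm x _))

  bilateral-swap : ∀ (U : ℤ → ℤ → Carrier) L M →
    bilateral (λ m → bilateral (U m) M) L ≈ bilateral (λ n → bilateral (λ m → U m n) L) M
  bilateral-swap U zero    M = refl
  bilateral-swap U (suc L) M = begin
    bilateral (λ m → bilateral (U m) M) L + (bilateral (U (+ suc L)) M + bilateral (U -[1+ L ]) M)
      ≈⟨ +-cong (bilateral-swap U L M) (sym (bilateral-+ (U (+ suc L)) (U -[1+ L ]) M)) ⟩
    bilateral (λ n → bilateral (λ m → U m n) L) M + bilateral (λ n → U (+ suc L) n + U -[1+ L ] n) M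
      ≈⟨ bilateral-+ _ _ M ⟨
    bilateral (λ n → bilateral (λ m → U m n) (suc L)) M ∎

  bilateral-product : ∀ (g h : ℤ → Carrier) L M →
    bilateral g L * bilateral h M ≈ bilateral (λ m → bilateral (λ n → g m * h n) M) L
  bilateral-product g h L M = begin
    bilateral g L * bilateral h M                 ≈⟨ bilateral-*ʳ _ g L ⟨
    bilateral (λ m → g m * bilateral h M) L       ≈⟨ bilateral-cong L (λ m → sym (bilateral-*ˡ (g m) h M)) ⟩
    bilateral (λ m → bilateral (λ n → g m * h n) M) L ∎

  bilateral-stable : ∀ {g M L} → Supported M g → M ℕ.≤ L → bilateral g L ≈ bilateral g M
  bilateral-stable {g} {M} supp M≤L = go (ℕ.≤⇒≤′ M≤L)
    where
    go : ∀ {L} → M ℕ.≤′ L → bilateral g L ≈ bilateral g M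
    go (ℕ.≤′-reflexive ≡.refl) = refl
    go (ℕ.≤′-step {L} M≤′L)    = begin
      bilateral g L + (g (+ suc L) + g -[1+ L ])  ≈⟨ +-cong (go M≤′L) (+-cong (supp _ M≤) (supp _ M≤)) ⟩
      bilateral g M + (0# + 0#)                   ≈⟨ +-congˡ (+-identityˡ 0#) ⟩
      bilateral g M + 0#                          ≈⟨ +-identityʳ _ ⟩
      bilateral g M                               ∎
      where M≤ = ℕ.m≤n⇒m≤1+n (ℕ.≤′⇒≤ M≤′L)

  bilateral-neg : ∀ (g : ℤ → Carrier) L → bilateral (λ j → g (ℤ.- j)) L ≈ bilateral g L
  bilateral-neg g zero    = refl
  bilateral-neg g (suc L) = +-cong (bilateral-neg g L) (+-comm _ _)

  -- Shifting the window by one drops its lowest term and gains one above; the two are placed on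
  -- opposite sides to avoid subtraction.
  bilateral-suc : ∀ (g : ℤ → Carrier) L →
    bilateral (λ j → g (ℤ.suc j)) L + g (ℤ.- (+ L)) ≈ bilateral g L + g (+ suc L)
  bilateral-suc g zero    = +-comm _ _
  bilateral-suc g (suc L) = begin
    (bilateral (λ j → g (ℤ.suc j)) L + (g (+ suc (suc L)) + g (ℤ.suc -[1+ L ]))) + g -[1+ L ]
      ≈⟨ +-congʳ (+-congˡ (+-congˡ (reflexive (≡.cong g (suc-neg L))))) ⟩
    (bilateral (λ j → g (ℤ.suc j)) L + (g (+ suc (suc L)) + g (ℤ.- (+ L)))) + g -[1+ L ]
      ≈⟨ solve 4 (λ a b c d → (a :+ (b :+ c)) :+ d := ((a :+ c) :+ d) :+ b) refl _ _ _ _ ⟩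
    ((bilateral (λ j → g (ℤ.suc j)) L + g (ℤ.- (+ L))) + g -[1+ L ]) + g (+ suc (suc L))
      ≈⟨ +-congʳ (trans (+-congʳ (bilateral-suc g L)) (+-assoc _ _ _)) ⟩
    bilateral g (suc L) + g (+ suc (suc L)) ∎
    where
    suc-neg : ∀ L → ℤ.suc -[1+ L ] ≡ ℤ.- (+ L)
    suc-neg zero    = ≡.refl
    suc-neg (suc L) = ≡.refl

  private
    shift-ℕ : ∀ n {g M L} → Supported M g → n ℕ.+ M ℕ.≤ L →
              bilateral (λ j → g (+ n ℤ.+ j)) L ≈ bilateral g L
    shift-ℕ zero    {g} {M} {L} supp n+M≤L = bilateral-cong L (λ j → reflexive (≡.cong g (ℤ.+-identityˡ j)))
    shift-ℕ (suc n) {g} {M} {L} supp n+M≤L = begin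
      bilateral (λ j → g (+ suc n ℤ.+ j)) L
        ≈⟨ bilateral-cong L (λ j → reflexive (≡.cong g (ℤ.+-assoc (+ 1) (+ n) j))) ⟩
      bilateral (λ j → h (+ n ℤ.+ j)) L
        ≈⟨ shift-ℕ n supp-h (ℕ.≤-trans (ℕ.≤-reflexive (ℕ.+-suc n M)) n+M≤L) ⟩
      bilateral h L
        ≈⟨ +-identityʳ _ ⟨
      bilateral h L + 0#
        ≈⟨ +-congˡ (supp (ℤ.- (+ L)) (ℕ.≤-trans M≤L (ℕ.≤-reflexive (≡.sym (ℤ.∣-i∣≡∣i∣ (+ L)))))) ⟨
      bilateral h L + g (ℤ.- (+ L))
        ≈⟨ bilateral-suc g L ⟩
      bilateral g L + g (+ suc L)
        ≈⟨ trans (+-congˡ (supp _ (ℕ.m≤n⇒m≤1+n M≤L))) (+-identityʳ _) ⟩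
      bilateral g L ∎
      where
      h : ℤ → Carrier
      h j = g (ℤ.suc j)
      M≤L : M ℕ.≤ L
      M≤L = ℕ.≤-trans (ℕ.m≤n+m M (suc n)) n+M≤L
      -- Each unit of shift may widen the support by one; the bound `n + M ≤ L` pays for it, one
      -- unit moving from the shift to the support.
      supp-h : Supported (suc M) h
      supp-h j M<∣j∣ = supp (ℤ.suc j) (below j M<∣j∣)
        where
        below : ∀ j → suc M ℕ.≤ ∣ j ∣ → M ℕ.≤ ∣ ℤ.suc j ∣
        below (+ k)          M<k       = ℕ.≤-trans (ℕ.n≤1+n M) (ℕ.m≤n⇒m≤1+n M<k)
        below -[1+ zero ]    (s≤s M≤0) = M≤0
        below -[1+ suc k ]   (s≤s M≤k) = M≤k

  bilateral-shift : ∀ i {g M L} → Supported M g → ∣ i ∣ ℕ.+ M ℕ.≤ L →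
                    bilateral (λ j → g (i ℤ.+ j)) L ≈ bilateral g L
  bilateral-shift (+ n)    supp bound = shift-ℕ n supp bound
  bilateral-shift -[1+ n ] {g} {M} {L} supp bound = begin
    bilateral (λ j → g (-[1+ n ] ℤ.+ j)) L
      ≈⟨ bilateral-neg _ L ⟨
    bilateral (λ j → g (-[1+ n ] ℤ.+ ℤ.- j)) L
      ≈⟨ bilateral-cong L (λ j → reflexive (≡.cong g (≡.sym (ℤ.neg-distrib-+ (+ suc n) j)))) ⟩
    bilateral (λ j → g (ℤ.- (+ suc n ℤ.+ j))) L
      ≈⟨ shift-ℕ (suc n) {λ j → g (ℤ.- j)} (λ j M≤ → supp (ℤ.- j) (ℕ.≤-trans M≤ (ℕ.≤-reflexive (≡.sym (ℤ.∣-i∣≡∣i∣ j))))) bound ⟩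
    bilateral (λ j → g (ℤ.- j)) L
      ≈⟨ bilateral-neg g L ⟩
    bilateral g L ∎

  -- The odd numbers `2 i + 1` with `∣ i ∣ ≤ L` reach up to `2 L + 1`, one beyond the window of size
  -- `2 L`; hence the extra term on the left.
  bilateral-parity : ∀ (g : ℤ → Carrier) L →
    bilateral g (L ℕ.+ L) + g (+ suc (L ℕ.+ L))
    ≈ bilateral (λ i → g (i ℤ.+ i)) L + bilateral (λ i → g (ℤ.suc (i ℤ.+ i))) L
  bilateral-parity g zero    = refl
  bilateral-parity g (suc L) rewrite ℕ.+-suc L L = trans
    (solve 6 (λ b x y z w v → ((b :+ (x :+ y)) :+ (z :+ w)) :+ v := (b :+ x) :+ ((z :+ w) :+ (v :+ y))) refl _ _ _ _ _ _)
    (trans (+-congʳ (bilateral-parity g L))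
    (solve 4 (λ p q r s → (p :+ q) :+ (r :+ s) := (p :+ r) :+ (q :+ s)) refl _ _ _ _))

  private
    ∣i∣≤∣i+i∣ : ∀ i → ∣ i ∣ ℕ.≤ ∣ i ℤ.+ i ∣
    ∣i∣≤∣i+i∣ (+ n)    = ℕ.m≤m+n n n
    ∣i∣≤∣i+i∣ -[1+ n ] = s≤s (ℕ.m≤n⇒m≤1+n (ℕ.m≤m+n n n))

    ∣i∣≤∣1+i+i∣ : ∀ i → ∣ i ∣ ℕ.≤ ∣ ℤ.suc (i ℤ.+ i) ∣
    ∣i∣≤∣1+i+i∣ (+ n)    = ℕ.m≤n⇒m≤1+n (ℕ.m≤m+n n n)
    ∣i∣≤∣1+i+i∣ -[1+ n ] = s≤s (ℕ.m≤m+n n n)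

  -- The substitutions (m, n) = (s + t, s − t) and (s + t, 1 + s − t) enumerate
  -- the pairs with m + n even and odd, respectively.
  bilateral-rotate : ∀ (U : ℤ → ℤ → Carrier) L → K ℕ.≤ L →
    (∀ m n → K ℕ.≤ ∣ m ∣ ℕ.+ ∣ n ∣ → U m n ≈ 0#) →
    bilateral (λ m → bilateral (U m) (L ℕ.+ L)) (L ℕ.+ L)
    ≈ bilateral (λ s → bilateral (λ t → U (s ℤ.+ t) (s ℤ.- t)) (L ℕ.+ L)) L
      + bilateral (λ s → bilateral (λ t → U (s ℤ.+ t) (ℤ.suc (s ℤ.- t))) (L ℕ.+ L)) L
  bilateral-rotate U L K≤L vanish = begin
    bilateral (λ m → bilateral (U m) N) N
      ≈⟨ bilateral-cong N (λ m → sym (shear m)) ⟩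
    bilateral (λ m → bilateral (λ d → U m (ℤ.- m ℤ.+ d)) N) N
      -- With `d = m + n` as inner index, exchanging the sums makes `D d` the sum along the line
      -- `m + n = d`; these lines are then separated by the parity of `d`.
      ≈⟨ bilateral-swap (λ m d → U m (ℤ.- m ℤ.+ d)) N N ⟩
    bilateral D N
      -- The term that the parity split asks for is zero, since `∣ m ∣ + ∣ n ∣ ≥ ∣ d ∣ ≥ K` on that
      -- line.
      ≈⟨ trans (+-congˡ D-vanish) (+-identityʳ _) ⟨
    bilateral D N + D (+ suc N)
      ≈⟨ bilateral-parity D L ⟩
    bilateral (λ s → D (s ℤ.+ s)) L + bilateral (λ s → D (ℤ.suc (s ℤ.+ s))) L
      ≈⟨ +-cong (bilateral-cong L (λ s → recentre s (s ℤ.+ s) (λ t → s ℤ.- t) (∣i∣≤∣i+i∣ s) (even-index s)))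
                (bilateral-cong L (λ s → recentre s (ℤ.suc (s ℤ.+ s)) (λ t → ℤ.suc (s ℤ.- t)) (∣i∣≤∣1+i+i∣ s) (odd-index s))) ⟩
    bilateral (λ s → bilateral (λ t → U (s ℤ.+ t) (s ℤ.- t)) N) L
      + bilateral (λ s → bilateral (λ t → U (s ℤ.+ t) (ℤ.suc (s ℤ.- t))) N) L ∎
    where
    N = L ℕ.+ L
    D : ℤ → Carrier
    D d = bilateral (λ m → U m (ℤ.- m ℤ.+ d)) N
    ∣d∣≤ : ∀ m d → ∣ d ∣ ℕ.≤ ∣ m ∣ ℕ.+ ∣ ℤ.- m ℤ.+ d ∣
    ∣d∣≤ m d = ℕ.≤-trans (ℕ.≤-reflexive (≡.cong ∣_∣ (shear-index m d))) (ℤ.∣i+j∣≤∣i∣+∣j∣ m (ℤ.- m ℤ.+ d))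
    window : ∀ {k} → k ℕ.≤ K → k ℕ.+ K ℕ.≤ N
    window k≤K = ℕ.+-mono-≤ (ℕ.≤-trans k≤K K≤L) K≤L
    shear : ∀ m → bilateral (λ d → U m (ℤ.- m ℤ.+ d)) N ≈ bilateral (U m) N
    shear m with K ℕ.≤? ∣ m ∣
    ... | yes K≤∣m∣ = trans (bilateral-zero N (λ d → vanish m _ (ℕ.≤-trans K≤∣m∣ (ℕ.m≤m+n _ _))))
                       (sym (bilateral-zero N (λ d → vanish m d (ℕ.≤-trans K≤∣m∣ (ℕ.m≤m+n _ _)))))
    ... | no K≰∣m∣  = bilateral-shift (ℤ.- m) {M = K} (λ n K≤∣n∣ → vanish m n (ℕ.≤-trans K≤∣n∣ (ℕ.m≤n+m _ ∣ m ∣)))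
                       (window (ℕ.≤-trans (ℕ.≤-reflexive (ℤ.∣-i∣≡∣i∣ m)) (ℕ.<⇒≤ (ℕ.≰⇒> K≰∣m∣))))
    D-vanish : D (+ suc N) ≈ 0#
    D-vanish = bilateral-zero N (λ m → vanish m _ (ℕ.≤-trans (ℕ.m≤n⇒m≤1+n (ℕ.≤-trans K≤L (ℕ.m≤m+n L L))) (∣d∣≤ m (+ suc N))))
    recentre : ∀ s d (n : ℤ → ℤ) → ∣ s ∣ ℕ.≤ ∣ d ∣ → (∀ t → ℤ.- (s ℤ.+ t) ℤ.+ d ≡ n t) →
               D d ≈ bilateral (λ t → U (s ℤ.+ t) (n t)) N
    recentre s d n ∣s∣≤∣d∣ eq = trans (go (K ℕ.≤? ∣ s ∣)) (bilateral-cong N (λ t → reflexive (≡.cong (U (s ℤ.+ t)) (eq t))))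
      where
      go : Dec (K ℕ.≤ ∣ s ∣) → D d ≈ bilateral (λ t → U (s ℤ.+ t) (ℤ.- (s ℤ.+ t) ℤ.+ d)) N
      -- For `∣ s ∣ ≥ K` the whole line lies where `U` vanishes; for smaller `s` a shift by `s` of a
      -- support of size `K` still fits into `N = 2 L`.
      go (yes K≤∣s∣) = trans (bilateral-zero N (λ m → zeros m)) (sym (bilateral-zero N (λ t → zeros (s ℤ.+ t))))
        where
        zeros : ∀ m → U m (ℤ.- m ℤ.+ d) ≈ 0#
        zeros m = vanish m _ (ℕ.≤-trans K≤∣s∣ (ℕ.≤-trans ∣s∣≤∣d∣ (∣d∣≤ m d)))
      go (no K≰∣s∣) = sym (bilateral-shift s {λ m → U m (ℤ.- m ℤ.+ d)} {K}
        (λ m K≤∣m∣ → vanish m _ (ℕ.≤-trans K≤∣m∣ (ℕ.m≤m+n _ _))) (window (ℕ.<⇒≤ (ℕ.≰⇒> K≰∣s∣))))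

-- Exponents of theta terms as quadratic polynomials

-- The exponent of `q` in `term (q ^ α) (q ^ β) j`. At `α = β = 1` it is `j²`, the exponent of a
-- common sign.
quad : ℕ → ℕ → ℤ → ℕ
quad α β j = α ℕ.* up j ℕ.+ β ℕ.* down j

∣j∣≤quad : ∀ {α β} j → 1 ℕ.≤ α → 1 ℕ.≤ β → ∣ j ∣ ℕ.≤ quad α β j
∣j∣≤quad {α} {β} j 1≤α 1≤β = ℕ.≤-trans (∣j∣≤up+down j)
  (ℕ.+-mono-≤ (ℕ.m≤n*m (up j) α {{ℕ.>-nonZero 1≤α}}) (ℕ.m≤n*m (down j) β {{ℕ.>-nonZero 1≤β}}))

private
  -- Doubled triangular numbers are integer polynomials, so exponent identities are proved doubled
  -- over ℤ by the ring solver and returned to ℕ by `double-injective`.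
  2triangle : ∀ n → + triangle n ℤ.+ + triangle n ≡ + n ℤ.* + n ℤ.- + n
  2triangle zero    = ≡.refl
  2triangle (suc n) = begin
    (+ n ℤ.+ t) ℤ.+ (+ n ℤ.+ t)                        ≡⟨ solve 2 (λ n t → (n :+ t) :+ (n :+ t) := n :+ n :+ (t :+ t)) ≡.refl (+ n) t ⟩
    + n ℤ.+ + n ℤ.+ (t ℤ.+ t)                          ≡⟨ ≡.cong (λ x → + n ℤ.+ + n ℤ.+ x) (2triangle n) ⟩
    + n ℤ.+ + n ℤ.+ (+ n ℤ.* + n ℤ.- + n)              ≡⟨ solve 1 (λ n → n :+ n :+ (n :* n :- n) := (con (+ 1) :+ n) :* (con (+ 1) :+ n) :- (con (+ 1) :+ n)) ≡.refl (+ n) ⟩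
    + suc n ℤ.* + suc n ℤ.- + suc n                    ∎
    where
    t = + triangle n
    open ≡.≡-Reasoning
    open ℤSolver.+-*-Solver

  2up : ∀ j → + up j ℤ.+ + up j ≡ j ℤ.* j ℤ.+ j
  2up (+ n)    = ≡.trans (2triangle (suc n))
    (solve 1 (λ n → (con (+ 1) :+ n) :* (con (+ 1) :+ n) :- (con (+ 1) :+ n) := n :* n :+ n) ≡.refl (+ n))
    where open ℤSolver.+-*-Solver
  2up -[1+ n ] = ≡.trans (2triangle (suc n))
    (solve 1 (λ n → n :* n :- n := (:- n) :* (:- n) :+ (:- n)) ≡.refl (+ suc n))
    where open ℤSolver.+-*-Solver

  2down : ∀ j → + down j ℤ.+ + down j ≡ j ℤ.* j ℤ.- j
  2down (+ n)    = 2triangle n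
  2down -[1+ n ] = ≡.trans (2triangle (suc (suc n)))
    (solve 1 (λ n → (con (+ 1) :+ n) :* (con (+ 1) :+ n) :- (con (+ 1) :+ n) := (:- n) :* (:- n) :- (:- n)) ≡.refl (+ suc n))
    where open ℤSolver.+-*-Solver

  2quad : ∀ α β j → + quad α β j ℤ.+ + quad α β j ≡ + α ℤ.* (j ℤ.* j ℤ.+ j) ℤ.+ + β ℤ.* (j ℤ.* j ℤ.- j)
  2quad α β j = begin
    + quad α β j ℤ.+ + quad α β j
      ≡⟨ ≡.cong₂ (λ x y → (x ℤ.+ y) ℤ.+ (x ℤ.+ y)) (ℤ.pos-* α (up j)) (ℤ.pos-* β (down j)) ⟩
    (+ α ℤ.* + up j ℤ.+ + β ℤ.* + down j) ℤ.+ (+ α ℤ.* + up j ℤ.+ + β ℤ.* + down j)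
      ≡⟨ solve 4 (λ α β u d → (α :* u :+ β :* d) :+ (α :* u :+ β :* d) := α :* (u :+ u) :+ β :* (d :+ d)) ≡.refl (+ α) (+ β) (+ up j) (+ down j) ⟩
    + α ℤ.* (+ up j ℤ.+ + up j) ℤ.+ + β ℤ.* (+ down j ℤ.+ + down j)
      ≡⟨ ≡.cong₂ (λ x y → + α ℤ.* x ℤ.+ + β ℤ.* y) (2up j) (2down j) ⟩
    + α ℤ.* (j ℤ.* j ℤ.+ j) ℤ.+ + β ℤ.* (j ℤ.* j ℤ.- j) ∎
    where
    open ≡.≡-Reasoning
    open ℤSolver.+-*-Solver

  double-injective : ∀ {m n} → + m ℤ.+ + m ≡ + n ℤ.+ + n → m ≡ n
  double-injective {m} {n} eq = ℕ.*-cancelˡ-≡ m n 2 (begin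
    m ℕ.+ (m ℕ.+ 0)  ≡⟨ ≡.cong (m ℕ.+_) (ℕ.+-identityʳ m) ⟩
    m ℕ.+ m          ≡⟨ ℤ.+-injective eq ⟩
    n ℕ.+ n          ≡⟨ ≡.cong (n ℕ.+_) (ℕ.+-identityʳ n) ⟨
    n ℕ.+ (n ℕ.+ 0)  ∎)
    where open ≡.≡-Reasoning

  interchange : ∀ x y → (x ℤ.+ y) ℤ.+ (x ℤ.+ y) ≡ (x ℤ.+ x) ℤ.+ (y ℤ.+ y)
  interchange = solve 2 (λ x y → (x :+ y) :+ (x :+ y) := (x :+ x) :+ (y :+ y)) ≡.refl
    where open ℤSolver.+-*-Solver

  2quad+quad : ∀ α β i γ δ j →
    + (quad α β i ℕ.+ quad γ δ j) ℤ.+ + (quad α β i ℕ.+ quad γ δ j)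
    ≡ (+ α ℤ.* (i ℤ.* i ℤ.+ i) ℤ.+ + β ℤ.* (i ℤ.* i ℤ.- i)) ℤ.+ (+ γ ℤ.* (j ℤ.* j ℤ.+ j) ℤ.+ + δ ℤ.* (j ℤ.* j ℤ.- j))
  2quad+quad α β i γ δ j = ≡.trans (interchange (+ quad α β i) (+ quad γ δ j)) (≡.cong₂ ℤ._+_ (2quad α β i) (2quad γ δ j))

-- Both pairs of exponents have the sum `2 (b + d) + κ`, so the cross terms `s t` cancel and the
-- exponent separates into a part in `s` and a part in `t`.
quad-even : ∀ b d κ s t →
  quad (b ℕ.+ b ℕ.+ d) (d ℕ.+ κ) (s ℤ.+ t) ℕ.+ quad d (b ℕ.+ b ℕ.+ d ℕ.+ κ) (s ℤ.- t)
  ≡ quad (b ℕ.+ b ℕ.+ d ℕ.+ d) (b ℕ.+ b ℕ.+ d ℕ.+ d ℕ.+ κ ℕ.+ κ) s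
    ℕ.+ quad (b ℕ.+ b ℕ.+ b ℕ.+ b ℕ.+ d ℕ.+ d ℕ.+ κ) (d ℕ.+ d ℕ.+ κ) t
quad-even b d κ s t = double-injective (≡.trans
  (2quad+quad (b ℕ.+ b ℕ.+ d) (d ℕ.+ κ) (s ℤ.+ t) d (b ℕ.+ b ℕ.+ d ℕ.+ κ) (s ℤ.- t)) (≡.trans
  (solve 5 (λ b d κ s t →
     ((b :+ b :+ d) :* ((s :+ t) :* (s :+ t) :+ (s :+ t)) :+ (d :+ κ) :* ((s :+ t) :* (s :+ t) :- (s :+ t)))
       :+ (d :* ((s :- t) :* (s :- t) :+ (s :- t)) :+ (b :+ b :+ d :+ κ) :* ((s :- t) :* (s :- t) :- (s :- t)))
     := ((b :+ b :+ d :+ d) :* (s :* s :+ s) :+ (b :+ b :+ d :+ d :+ κ :+ κ) :* (s :* s :- s))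
       :+ ((b :+ b :+ b :+ b :+ d :+ d :+ κ) :* (t :* t :+ t) :+ (d :+ d :+ κ) :* (t :* t :- t)))
     ≡.refl (+ b) (+ d) (+ κ) s t)
  (≡.sym (2quad+quad (b ℕ.+ b ℕ.+ d ℕ.+ d) (b ℕ.+ b ℕ.+ d ℕ.+ d ℕ.+ κ ℕ.+ κ) s (b ℕ.+ b ℕ.+ b ℕ.+ b ℕ.+ d ℕ.+ d ℕ.+ κ) (d ℕ.+ d ℕ.+ κ) t))))
  where open ℤSolver.+-*-Solver

-- The extra 1 in the second index adds only linear terms and the constant `d`, so the variables
-- still separate; `d` becomes the prefactor `q ^ d`.
quad-odd : ∀ b d κ s t →
  quad (b ℕ.+ b ℕ.+ d) (d ℕ.+ κ) (s ℤ.+ t) ℕ.+ quad d (b ℕ.+ b ℕ.+ d ℕ.+ κ) (ℤ.suc (s ℤ.- t))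
  ≡ d ℕ.+ (quad (b ℕ.+ b ℕ.+ b ℕ.+ b ℕ.+ d ℕ.+ d ℕ.+ d ℕ.+ d ℕ.+ κ) κ s
           ℕ.+ quad (b ℕ.+ b) (b ℕ.+ b ℕ.+ d ℕ.+ d ℕ.+ d ℕ.+ d ℕ.+ κ ℕ.+ κ) t)
quad-odd b d κ s t = double-injective (≡.trans
  (2quad+quad (b ℕ.+ b ℕ.+ d) (d ℕ.+ κ) (s ℤ.+ t) d (b ℕ.+ b ℕ.+ d ℕ.+ κ) (ℤ.suc (s ℤ.- t))) (≡.trans
  (solve 5 (λ b d κ s t →
     ((b :+ b :+ d) :* ((s :+ t) :* (s :+ t) :+ (s :+ t)) :+ (d :+ κ) :* ((s :+ t) :* (s :+ t) :- (s :+ t)))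
       :+ (d :* ((con (+ 1) :+ (s :- t)) :* (con (+ 1) :+ (s :- t)) :+ (con (+ 1) :+ (s :- t)))
           :+ (b :+ b :+ d :+ κ) :* ((con (+ 1) :+ (s :- t)) :* (con (+ 1) :+ (s :- t)) :- (con (+ 1) :+ (s :- t))))
     := (d :+ d) :+ (((b :+ b :+ b :+ b :+ d :+ d :+ d :+ d :+ κ) :* (s :* s :+ s) :+ κ :* (s :* s :- s))
       :+ ((b :+ b) :* (t :* t :+ t) :+ (b :+ b :+ d :+ d :+ d :+ d :+ κ :+ κ) :* (t :* t :- t))))
     ≡.refl (+ b) (+ d) (+ κ) s t) (≡.sym (≡.trans
  (interchange (+ d) (+ (quad (b ℕ.+ b ℕ.+ b ℕ.+ b ℕ.+ d ℕ.+ d ℕ.+ d ℕ.+ d ℕ.+ κ) κ s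
           ℕ.+ quad (b ℕ.+ b) (b ℕ.+ b ℕ.+ d ℕ.+ d ℕ.+ d ℕ.+ d ℕ.+ κ ℕ.+ κ) t)))
  (≡.cong (λ x → + d ℤ.+ + d ℤ.+ x)
    (2quad+quad (b ℕ.+ b ℕ.+ b ℕ.+ b ℕ.+ d ℕ.+ d ℕ.+ d ℕ.+ d ℕ.+ κ) κ s (b ℕ.+ b) (b ℕ.+ b ℕ.+ d ℕ.+ d ℕ.+ d ℕ.+ d ℕ.+ κ ℕ.+ κ) t))))))
  where open ℤSolver.+-*-Solver

-- A sign occurs to the power `m² + n²`, which has the parity of `m + n`. It therefore disappears
-- from the even half of the double sum and survives once in the odd half (`sign-odd`).
sign-even : ∀ s t → quad 1 1 (s ℤ.+ t) ℕ.+ quad 1 1 (s ℤ.- t) ≡ (quad 1 1 s ℕ.+ quad 1 1 t) ℕ.+ (quad 1 1 s ℕ.+ quad 1 1 t)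
sign-even s t = double-injective (≡.trans (2quad+quad 1 1 (s ℤ.+ t) 1 1 (s ℤ.- t)) (≡.trans
  (solve 2 (λ s t →
     (con (+ 1) :* ((s :+ t) :* (s :+ t) :+ (s :+ t)) :+ con (+ 1) :* ((s :+ t) :* (s :+ t) :- (s :+ t)))
       :+ (con (+ 1) :* ((s :- t) :* (s :- t) :+ (s :- t)) :+ con (+ 1) :* ((s :- t) :* (s :- t) :- (s :- t)))
     := half s t :+ half s t) ≡.refl s t)
  (≡.sym (≡.trans (interchange (+ w) (+ w)) (≡.cong₂ ℤ._+_ (2quad+quad 1 1 s 1 1 t) (2quad+quad 1 1 s 1 1 t))))))
  where
  open ℤSolver.+-*-Solver
  w = quad 1 1 s ℕ.+ quad 1 1 t
  half : ∀ {n} → Polynomial n → Polynomial n → Polynomial n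
  half s t = (con (+ 1) :* (s :* s :+ s) :+ con (+ 1) :* (s :* s :- s)) :+ (con (+ 1) :* (t :* t :+ t) :+ con (+ 1) :* (t :* t :- t))

sign-odd : ∀ s t → quad 1 1 (s ℤ.+ t) ℕ.+ quad 1 1 (ℤ.suc (s ℤ.- t)) ≡ 1 ℕ.+ ((quad 2 0 s ℕ.+ quad 0 2 t) ℕ.+ (quad 2 0 s ℕ.+ quad 0 2 t))
sign-odd s t = double-injective (≡.trans (2quad+quad 1 1 (s ℤ.+ t) 1 1 (ℤ.suc (s ℤ.- t))) (≡.trans
  (solve 2 (λ s t →
     (con (+ 1) :* ((s :+ t) :* (s :+ t) :+ (s :+ t)) :+ con (+ 1) :* ((s :+ t) :* (s :+ t) :- (s :+ t)))
       :+ (con (+ 1) :* ((con (+ 1) :+ (s :- t)) :* (con (+ 1) :+ (s :- t)) :+ (con (+ 1) :+ (s :- t)))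
           :+ con (+ 1) :* ((con (+ 1) :+ (s :- t)) :* (con (+ 1) :+ (s :- t)) :- (con (+ 1) :+ (s :- t))))
     := con (+ 2) :+ (half s t :+ half s t)) ≡.refl s t)
  (≡.sym (≡.trans (interchange (+ 1) (+ w ℤ.+ + w)) (≡.cong (λ x → + 2 ℤ.+ x) (≡.trans (interchange (+ w) (+ w))
    (≡.cong₂ ℤ._+_ (2quad+quad 2 0 s 0 2 t) (2quad+quad 2 0 s 0 2 t))))))))
  where
  open ℤSolver.+-*-Solver
  w = quad 2 0 s ℕ.+ quad 0 2 t
  half : ∀ {n} → Polynomial n → Polynomial n → Polynomial n
  half s t = (con (+ 2) :* (s :* s :+ s) :+ con (+ 0) :* (s :* s :- s)) :+ (con (+ 0) :* (t :* t :+ t) :+ con (+ 2) :* (t :* t :- t))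

-- The product of two theta series

module ThetaProducts {c ℓ : Level} (R : CommutativeRing c ℓ) (K : ℕ) (q : CommutativeRing.Carrier R)
  (q^K≈0 : CommutativeRing._≈_ R (SemiringExp._^_ (CommutativeRing.semiring R) q K) (CommutativeRing.0# R)) where
  open CommutativeRing R hiding (zero)
  open Sums R
  open JacobiTripleProduct R
  open Nilpotent R K
  open BilateralSums R K
  open NaturalSolver commutativeSemiring using (solve; _:*_; _:=_)
  open SemiringExp semiring using (_^_; ^-homo-*; ^-congʳ; ^-congˡ; ^-assocʳ)
  open CommutativeSemiringExp commutativeSemiring using (^-distrib-*)
  open SetoidReasoning setoid

  q^-nilpotent : ∀ {α} → 1 ℕ.≤ α → (q ^ α) ^ K ≈ 0#
  q^-nilpotent {α} 1≤α = trans (^-assocʳ q α K) (^-vanish q^K≈0 (ℕ.m≤n*m K α {{ℕ.>-nonZero 1≤α}}))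

  term-monomial : ∀ s α β j → term (s * q ^ α) (s * q ^ β) j ≈ s ^ quad 1 1 j * q ^ quad α β j
  term-monomial s α β j = begin
    (s * q ^ α) ^ up j * (s * q ^ β) ^ down j
      ≈⟨ *-cong (^-distrib-* s (q ^ α) (up j)) (^-distrib-* s (q ^ β) (down j)) ⟩
    s ^ up j * (q ^ α) ^ up j * (s ^ down j * (q ^ β) ^ down j)
      ≈⟨ solve 4 (λ x y z w → x :* y :* (z :* w) := x :* z :* (y :* w)) refl _ _ _ _ ⟩
    s ^ up j * s ^ down j * ((q ^ α) ^ up j * (q ^ β) ^ down j)
      ≈⟨ *-cong (sym (^-homo-* s (up j) (down j))) (*-cong (^-assocʳ q α (up j)) (^-assocʳ q β (down j))) ⟩
    s ^ (up j ℕ.+ down j) * (q ^ (α ℕ.* up j) * q ^ (β ℕ.* down j))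
      ≈⟨ *-cong (^-congʳ s (≡.cong₂ ℕ._+_ (≡.sym (ℕ.*-identityˡ (up j))) (≡.sym (ℕ.*-identityˡ (down j))))) (sym (^-homo-* q (α ℕ.* up j) (β ℕ.* down j))) ⟩
    s ^ quad 1 1 j * q ^ quad α β j ∎

  term-q : ∀ α β j → term (q ^ α) (q ^ β) j ≈ q ^ quad α β j
  term-q α β j = trans (*-cong (^-assocʳ q α (up j)) (^-assocʳ q β (down j))) (sym (^-homo-* q (α ℕ.* up j) (β ℕ.* down j)))

  term-q-supported : ∀ {α β} → 1 ℕ.≤ α → 1 ℕ.≤ β → Supported K (term (q ^ α) (q ^ β))
  term-q-supported 1≤α 1≤β = term-vanish (q^-nilpotent 1≤α) (q^-nilpotent 1≤β)

  term-*-monomial : ∀ s α β γ δ m n →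
    term (s * q ^ α) (s * q ^ β) m * term (s * q ^ γ) (s * q ^ δ) n
    ≈ s ^ (quad 1 1 m ℕ.+ quad 1 1 n) * q ^ (quad α β m ℕ.+ quad γ δ n)
  term-*-monomial s α β γ δ m n = begin
    term (s * q ^ α) (s * q ^ β) m * term (s * q ^ γ) (s * q ^ δ) n
      ≈⟨ *-cong (term-monomial s α β m) (term-monomial s γ δ n) ⟩
    s ^ quad 1 1 m * q ^ quad α β m * (s ^ quad 1 1 n * q ^ quad γ δ n)
      ≈⟨ solve 4 (λ x y z w → x :* y :* (z :* w) := x :* z :* (y :* w)) refl _ _ _ _ ⟩
    s ^ quad 1 1 m * s ^ quad 1 1 n * (q ^ quad α β m * q ^ quad γ δ n)
      ≈⟨ *-cong (sym (^-homo-* s (quad 1 1 m) (quad 1 1 n))) (sym (^-homo-* q (quad α β m) (quad γ δ n))) ⟩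
    s ^ (quad 1 1 m ℕ.+ quad 1 1 n) * q ^ (quad α β m ℕ.+ quad γ δ n) ∎

  s^[w+w] : ∀ {s} w → s * s ≈ 1# → s ^ (w ℕ.+ w) ≈ 1#
  s^[w+w] {s} w ss≈1 = trans (^-homo-* s w w) (trans (sym (^-distrib-* s s w)) (trans (^-congˡ w ss≈1) (one w)))
    where
    one : ∀ w → 1# ^ w ≈ 1#
    one zero    = refl
    one (suc w) = trans (*-identityˡ _) (one w)

  f : ℕ → Carrier → Carrier → Carrier
  f N a b = bilateral (term a b) N

  -- Ramanujan's expansion of a product of two theta series f(x, x′) f(y, y′) with x x′ = y y′.
  -- Here x x′ = q^(2 (b + d) + κ); in these parameters no exponent contains a subtraction.
  f-* : ∀ {s} → s * s ≈ 1# → ∀ b d κ L → 1 ℕ.≤ d → 1 ℕ.≤ κ → K ℕ.≤ L → let N = L ℕ.+ L in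
    f N (s * q ^ (b ℕ.+ b ℕ.+ d)) (s * q ^ (d ℕ.+ κ)) * f N (s * q ^ d) (s * q ^ (b ℕ.+ b ℕ.+ d ℕ.+ κ))
    ≈ f N (q ^ (b ℕ.+ b ℕ.+ d ℕ.+ d)) (q ^ (b ℕ.+ b ℕ.+ d ℕ.+ d ℕ.+ κ ℕ.+ κ))
        * f N (q ^ (b ℕ.+ b ℕ.+ b ℕ.+ b ℕ.+ d ℕ.+ d ℕ.+ κ)) (q ^ (d ℕ.+ d ℕ.+ κ))
      + s * q ^ d * f N (q ^ (b ℕ.+ b ℕ.+ b ℕ.+ b ℕ.+ d ℕ.+ d ℕ.+ d ℕ.+ d ℕ.+ κ)) (q ^ κ)
        * f N (q ^ (b ℕ.+ b)) (q ^ (b ℕ.+ b ℕ.+ d ℕ.+ d ℕ.+ d ℕ.+ d ℕ.+ κ ℕ.+ κ))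
  f-* {s} ss≈1 b d κ L 1≤d 1≤κ K≤L = begin
    f N (s * q ^ α) (s * q ^ β) * f N (s * q ^ γ) (s * q ^ δ)
      ≈⟨ bilateral-product _ _ N N ⟩
    bilateral (λ m → bilateral (U m) N) N
      ≈⟨ bilateral-rotate U L K≤L vanish ⟩
    bilateral (λ i → bilateral (λ j → U (i ℤ.+ j) (i ℤ.- j)) N) L + bilateral (λ i → bilateral (λ j → U (i ℤ.+ j) (ℤ.suc (i ℤ.- j))) N) L
      ≈⟨ +-cong (separate G₀ H₀ (term-q-supported {g₁} {g₂} (≥1-+ (2b+d) d 1≤d) (≥1-+ _ κ 1≤κ)) even)
                (separate (λ i → s * q ^ d * G₁ i) H₁ (λ j K≤ → trans (*-congˡ (term-q-supported {h₃} {κ} (≥1-+ _ κ 1≤κ) 1≤κ j K≤)) (zeroʳ _)) odd) ⟩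
    bilateral G₀ N * bilateral H₀ N + bilateral (λ i → s * q ^ d * G₁ i) N * bilateral H₁ N
      ≈⟨ +-congˡ (*-congʳ (bilateral-*ˡ (s * q ^ d) G₁ N)) ⟩
    bilateral G₀ N * bilateral H₀ N + s * q ^ d * bilateral G₁ N * bilateral H₁ N ∎
    where
    N = L ℕ.+ L
    2b+d = b ℕ.+ b ℕ.+ d
    α = 2b+d
    β = d ℕ.+ κ
    γ = d
    δ = b ℕ.+ b ℕ.+ d ℕ.+ κ
    g₁ = b ℕ.+ b ℕ.+ d ℕ.+ d
    g₂ = b ℕ.+ b ℕ.+ d ℕ.+ d ℕ.+ κ ℕ.+ κ
    h₁ = b ℕ.+ b ℕ.+ b ℕ.+ b ℕ.+ d ℕ.+ d ℕ.+ κ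
    h₂ = d ℕ.+ d ℕ.+ κ
    h₃ = b ℕ.+ b ℕ.+ b ℕ.+ b ℕ.+ d ℕ.+ d ℕ.+ d ℕ.+ d ℕ.+ κ
    g₃ = b ℕ.+ b
    g₄ = b ℕ.+ b ℕ.+ d ℕ.+ d ℕ.+ d ℕ.+ d ℕ.+ κ ℕ.+ κ
    U : ℤ → ℤ → Carrier
    U m n = term (s * q ^ α) (s * q ^ β) m * term (s * q ^ γ) (s * q ^ δ) n
    G₀ H₀ G₁ H₁ : ℤ → Carrier
    G₀ = term (q ^ g₁) (q ^ g₂)
    H₀ = term (q ^ h₁) (q ^ h₂)
    G₁ = term (q ^ h₃) (q ^ κ)
    H₁ = term (q ^ g₃) (q ^ g₄)
    ≥1-+ : ∀ m n → 1 ℕ.≤ n → 1 ℕ.≤ m ℕ.+ n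
    ≥1-+ m n 1≤n = ℕ.≤-trans 1≤n (ℕ.m≤n+m n m)
    vanish : ∀ m n → K ℕ.≤ ∣ m ∣ ℕ.+ ∣ n ∣ → U m n ≈ 0#
    vanish m n K≤ = trans (term-*-monomial s α β γ δ m n) (trans (*-congˡ (^-vanish q^K≈0 (ℕ.≤-trans K≤
      (ℕ.+-mono-≤ (∣j∣≤quad m (≥1-+ (b ℕ.+ b) d 1≤d) (≥1-+ d κ 1≤κ)) (∣j∣≤quad n 1≤d (≥1-+ 2b+d κ 1≤κ)))))) (zeroʳ _))
    even : ∀ i j → U (i ℤ.+ j) (i ℤ.- j) ≈ G₀ i * H₀ j
    even i j = begin
      U (i ℤ.+ j) (i ℤ.- j)
        ≈⟨ term-*-monomial s α β γ δ (i ℤ.+ j) (i ℤ.- j) ⟩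
      s ^ (quad 1 1 (i ℤ.+ j) ℕ.+ quad 1 1 (i ℤ.- j)) * q ^ (quad α β (i ℤ.+ j) ℕ.+ quad γ δ (i ℤ.- j))
        ≈⟨ *-cong (trans (^-congʳ s (sign-even i j)) (s^[w+w] (quad 1 1 i ℕ.+ quad 1 1 j) ss≈1)) (^-congʳ q (quad-even b d κ i j)) ⟩
      1# * q ^ (quad g₁ g₂ i ℕ.+ quad h₁ h₂ j)
        ≈⟨ trans (*-identityˡ _) (^-homo-* q (quad g₁ g₂ i) (quad h₁ h₂ j)) ⟩
      q ^ quad g₁ g₂ i * q ^ quad h₁ h₂ j
        ≈⟨ *-cong (term-q g₁ g₂ i) (term-q h₁ h₂ j) ⟨
      G₀ i * H₀ j ∎
    odd : ∀ i j → U (i ℤ.+ j) (ℤ.suc (i ℤ.- j)) ≈ s * q ^ d * G₁ i * H₁ j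
    odd i j = begin
      U (i ℤ.+ j) (ℤ.suc (i ℤ.- j))
        ≈⟨ term-*-monomial s α β γ δ (i ℤ.+ j) (ℤ.suc (i ℤ.- j)) ⟩
      s ^ (quad 1 1 (i ℤ.+ j) ℕ.+ quad 1 1 (ℤ.suc (i ℤ.- j))) * q ^ (quad α β (i ℤ.+ j) ℕ.+ quad γ δ (ℤ.suc (i ℤ.- j)))
        ≈⟨ *-cong (trans (^-congʳ s (sign-odd i j)) (trans (*-congˡ (s^[w+w] (quad 2 0 i ℕ.+ quad 0 2 j) ss≈1)) (*-identityʳ s))) (^-congʳ q (quad-odd b d κ i j)) ⟩
      s * q ^ (d ℕ.+ (quad h₃ κ i ℕ.+ quad g₃ g₄ j))
        ≈⟨ *-congˡ (trans (^-homo-* q d (quad h₃ κ i ℕ.+ quad g₃ g₄ j)) (*-congˡ (^-homo-* q (quad h₃ κ i) (quad g₃ g₄ j)))) ⟩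
      s * (q ^ d * (q ^ quad h₃ κ i * q ^ quad g₃ g₄ j))
        ≈⟨ *-congˡ (*-congˡ (*-cong (term-q h₃ κ i) (term-q g₃ g₄ j))) ⟨
      s * (q ^ d * (G₁ i * H₁ j))
        ≈⟨ solve 4 (λ s x g h → s :* (x :* (g :* h)) := s :* x :* g :* h) refl s (q ^ d) (G₁ i) (H₁ j) ⟩
      s * q ^ d * G₁ i * H₁ j ∎
    separate : ∀ {V : ℤ → ℤ → Carrier} (G H : ℤ → Carrier) → Supported K G → (∀ i j → V i j ≈ G i * H j) →
               bilateral (λ i → bilateral (V i) N) L ≈ bilateral G N * bilateral H N
    separate {V} G H supp eq = begin
      bilateral (λ i → bilateral (V i) N) L
        ≈⟨ bilateral-cong L (λ i → bilateral-cong N (eq i)) ⟩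
      bilateral (λ i → bilateral (λ j → G i * H j) N) L
        ≈⟨ bilateral-product G H L N ⟨
      bilateral G L * bilateral H N
        -- The parity split has shrunk the outer window to `L`; the support of `G` lies below
        -- `K ≤ L`, so the window can be widened to `N` again.
        ≈⟨ *-congʳ (trans (bilateral-stable supp K≤L) (sym (bilateral-stable supp (ℕ.≤-trans K≤L (ℕ.m≤m+n L L))))) ⟩
      bilateral G N * bilateral H N ∎

-- Theta products as determinants and the three-term relation

module Weierstrass {c ℓ : Level} (R : CommutativeRing c ℓ) (K : ℕ) (q : CommutativeRing.Carrier R)
  (q^K≈0 : CommutativeRing._≈_ R (SemiringExp._^_ (CommutativeRing.semiring R) q K) (CommutativeRing.0# R))
  (L : ℕ) (K≤L : K ℕ.≤ L) (N : ℕ) where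
  open CommutativeRing R hiding (zero)
  open JacobiTripleProduct R
  open Nilpotent R K
  open ThetaProducts R K q q^K≈0
  open NaturalSolver commutativeSemiring using (solve; _:+_; _:*_; con; _:=_)
  open SemiringExp semiring using (_^_; ^-homo-*; ^-congʳ; ^-congˡ)
  open SetoidReasoning setoid
  open import Algebra.Properties.Ring ring using (-1*x≈-x; -‿involutive)

  ⟦_⟧ : Sign → Carrier
  ⟦ Sign.+ ⟧ = 1#
  ⟦ Sign.- ⟧ = - 1#

  -1*-1≈1 : - 1# * - 1# ≈ 1#
  -1*-1≈1 = trans (-1*x≈-x (- 1#)) (-‿involutive 1#)

  ⟦⟧-homo : ∀ σ τ → ⟦ σ Sign.* τ ⟧ ≈ ⟦ σ ⟧ * ⟦ τ ⟧
  ⟦⟧-homo Sign.+ τ      = sym (*-identityˡ _)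
  ⟦⟧-homo Sign.- Sign.+ = sym (*-identityʳ _)
  ⟦⟧-homo Sign.- Sign.- = sym -1*-1≈1

  ⟦⟧-square : ∀ σ → ⟦ σ ⟧ * ⟦ σ ⟧ ≈ 1#
  ⟦⟧-square Sign.+ = *-identityˡ 1#
  ⟦⟧-square Sign.- = -1*-1≈1

  opposite-⟦⟧ : ∀ σ → ⟦ Sign.opposite σ ⟧ ≈ - 1# * ⟦ σ ⟧
  opposite-⟦⟧ Sign.+ = sym (*-identityʳ _)
  opposite-⟦⟧ Sign.- = sym -1*-1≈1

  -- The triple product asks for at least `2 K` factors, and the parity split for a window of the
  -- form `L + L`.
  cutoff : ℕ
  cutoff = L ℕ.+ L

  -- θ σ e = (σ q^e; q^N)_∞ (σ q^(N − e); q^N)_∞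
  θ : Sign → ℕ → Carrier
  θ σ e = poch (⟦ Sign.opposite σ ⟧ * q ^ e) (q ^ N) cutoff * poch (⟦ Sign.opposite σ ⟧ * q ^ (N ℕ.∸ e)) (q ^ N) cutoff

  euler : Carrier
  euler = poch (- (q ^ N)) (q ^ N) cutoff

  -- With x = q^a: g a = ∑_j q^(N j (j − 1)) x^(2j) and h a = ∑_j q^(N j²) x^(2j).
  -- These are even in x, so a sign of x only enters through products of two signs.
  g h : ℕ → Carrier
  g a = f cutoff (q ^ (a ℕ.+ a)) (q ^ (N ℕ.+ N ℕ.∸ (a ℕ.+ a)))
  h a = f cutoff (q ^ (N ℕ.+ (a ℕ.+ a))) (q ^ (N ℕ.∸ (a ℕ.+ a)))

  -- The parameters multiply to `q ^ N` because the sign squares to 1. The sign is opposite because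
  -- `poch a` is the product of the `1 + a p^i`.
  θ-triple-product : ∀ σ {e} → 1 ℕ.≤ e → e ℕ.< N →
    euler * θ σ e ≈ f cutoff (⟦ Sign.opposite σ ⟧ * q ^ e) (⟦ Sign.opposite σ ⟧ * q ^ (N ℕ.∸ e))
  θ-triple-product σ {e} 1≤e e<N = begin
    euler * θ σ e
      ≈⟨ *-cong (poch-cong cutoff (-‿cong (sym p≈)) (sym p≈)) (*-cong (poch-cong cutoff refl (sym p≈)) (poch-cong cutoff refl (sym p≈))) ⟩
    poch (- (a * b)) (a * b) cutoff * (poch a (a * b) cutoff * poch b (a * b) cutoff)
      ≈⟨ triple-product cutoff (*-nilpotentʳ s (q^-nilpotent 1≤e)) (*-nilpotentʳ s (q^-nilpotent (ℕ.m<n⇒0<n∸m e<N)))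
           (ℕ.+-mono-≤ K≤L K≤L) ⟩
    f cutoff a b ∎
    where
    s = ⟦ Sign.opposite σ ⟧
    a = s * q ^ e
    b = s * q ^ (N ℕ.∸ e)
    p≈ : a * b ≈ q ^ N
    p≈ = begin
      s * q ^ e * (s * q ^ (N ℕ.∸ e))
        ≈⟨ solve 3 (λ s x y → s :* x :* (s :* y) := s :* s :* (x :* y)) refl s (q ^ e) (q ^ (N ℕ.∸ e)) ⟩
      s * s * (q ^ e * q ^ (N ℕ.∸ e))
        ≈⟨ *-cong (⟦⟧-square (Sign.opposite σ)) (sym (^-homo-* q e (N ℕ.∸ e))) ⟩
      1# * q ^ (e ℕ.+ (N ℕ.∸ e))
        ≈⟨ trans (*-identityˡ _) (^-congʳ q (ℕ.m+[n∸m]≡n (ℕ.<⇒≤ e<N))) ⟩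
      q ^ N ∎

  θ² : Sign → ℕ → ℕ → Carrier
  θ² σ a b = θ σ (a ℕ.+ b) * θ σ (a ℕ.∸ b)

  -- `f-*` with `d = a − b` and `κ = N − 2 a`: its even half is `g a * h b`, its odd half the other
  -- product. The remaining steps only rewrite exponents by `a = b + d` and `N = 2 a + κ`.
  θ²-determinant : ∀ σ {a b} → 1 ℕ.≤ b → b ℕ.< a → a ℕ.+ a ℕ.< N →
    euler * euler * θ² σ a b ≈ g a * h b + ⟦ Sign.opposite σ ⟧ * q ^ (a ℕ.∸ b) * h a * g b
  θ²-determinant σ {a} {b} 1≤b b<a 2a<N = begin
    euler * euler * (θ σ (a ℕ.+ b) * θ σ (a ℕ.∸ b))
      ≈⟨ solve 3 (λ e x y → e :* e :* (x :* y) := e :* x :* (e :* y)) refl euler (θ σ (a ℕ.+ b)) (θ σ (a ℕ.∸ b)) ⟩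
    euler * θ σ (a ℕ.+ b) * (euler * θ σ (a ℕ.∸ b))
      ≈⟨ *-cong (θ-triple-product σ (ℕ.≤-trans 1≤b (ℕ.m≤n+m b a)) (ℕ.<-trans (ℕ.+-monoʳ-< a b<a) 2a<N))
                (θ-triple-product σ 0<d (ℕ.≤-<-trans (ℕ.≤-trans (ℕ.m∸n≤m a b) (ℕ.m≤m+n a a)) 2a<N)) ⟩
    f cutoff (s * q ^ (a ℕ.+ b)) (s * q ^ (N ℕ.∸ (a ℕ.+ b))) * f cutoff (s * q ^ d) (s * q ^ (N ℕ.∸ d))
      ≡⟨ ≡.cong₂ _*_ (exponents s (≡.trans (≡.cong (ℕ._+ b) (≡.sym b+d≡a)) (solve₂ 2 (λ b d → b :+′ d :+′ b :=′ b :+′ b :+′ d) ≡.refl b d))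
                                  (complement (a ℕ.+ b) (≡.trans (≡.cong (λ x → x ℕ.+ b ℕ.+ (d ℕ.+ κ)) (≡.sym b+d≡a))
                                    (≡.trans (solve₂ 3 (λ b d κ → b :+′ d :+′ b :+′ (d :+′ κ) :=′ (b :+′ d) :+′ (b :+′ d) :+′ κ) ≡.refl b d κ) N-eq))))
                     (exponents s {d} ≡.refl
                                  (complement d (≡.trans (solve₂ 3 (λ b d κ → d :+′ (b :+′ b :+′ d :+′ κ) :=′ (b :+′ d) :+′ (b :+′ d) :+′ κ) ≡.refl b d κ) N-eq))) ⟩
    f cutoff (s * q ^ (b ℕ.+ b ℕ.+ d)) (s * q ^ (d ℕ.+ κ)) * f cutoff (s * q ^ d) (s * q ^ (b ℕ.+ b ℕ.+ d ℕ.+ κ))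
      ≈⟨ f-* (⟦⟧-square (Sign.opposite σ)) b d κ L 0<d (ℕ.m<n⇒0<n∸m 2a<N) K≤L ⟩
    f cutoff (q ^ (b ℕ.+ b ℕ.+ d ℕ.+ d)) (q ^ (b ℕ.+ b ℕ.+ d ℕ.+ d ℕ.+ κ ℕ.+ κ))
        * f cutoff (q ^ (b ℕ.+ b ℕ.+ b ℕ.+ b ℕ.+ d ℕ.+ d ℕ.+ κ)) (q ^ (d ℕ.+ d ℕ.+ κ))
      + s * q ^ d * f cutoff (q ^ (b ℕ.+ b ℕ.+ b ℕ.+ b ℕ.+ d ℕ.+ d ℕ.+ d ℕ.+ d ℕ.+ κ)) (q ^ κ)
        * f cutoff (q ^ (b ℕ.+ b)) (q ^ (b ℕ.+ b ℕ.+ d ℕ.+ d ℕ.+ d ℕ.+ d ℕ.+ κ ℕ.+ κ))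
      ≡⟨ ≡.cong₂ (λ x y → x + s * q ^ d * y * g′ (b ℕ.+ b) (b ℕ.+ b ℕ.+ d ℕ.+ d ℕ.+ d ℕ.+ d ℕ.+ κ ℕ.+ κ))
           (≡.cong₂ _*_ (≡.cong₂ g′ 2a-eq
                          (≡.sym (complement (a ℕ.+ a) (≡.trans (≡.cong (ℕ._+ (b ℕ.+ b ℕ.+ d ℕ.+ d ℕ.+ κ ℕ.+ κ)) (≡.sym 2a-eq)) (≡.trans
                            (solve₂ 3 (λ b d κ → (b :+′ b :+′ d :+′ d) :+′ (b :+′ b :+′ d :+′ d :+′ κ :+′ κ) :=′ ((b :+′ d) :+′ (b :+′ d) :+′ κ) :+′ ((b :+′ d) :+′ (b :+′ d) :+′ κ)) ≡.refl b d κ)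
                            (≡.cong₂ ℕ._+_ N-eq N-eq))))))
                        (≡.cong₂ g′ (≡.trans (solve₂ 3 (λ b d κ → b :+′ b :+′ b :+′ b :+′ d :+′ d :+′ κ :=′ ((b :+′ d) :+′ (b :+′ d) :+′ κ) :+′ (b :+′ b)) ≡.refl b d κ) (≡.cong (ℕ._+ (b ℕ.+ b)) N-eq))
                          (≡.sym (complement (b ℕ.+ b) (≡.trans (solve₂ 3 (λ b d κ → b :+′ b :+′ (d :+′ d :+′ κ) :=′ (b :+′ d) :+′ (b :+′ d) :+′ κ) ≡.refl b d κ) N-eq)))))
           (≡.cong (λ x → g′ x κ) (≡.trans (solve₂ 3 (λ b d κ → b :+′ b :+′ b :+′ b :+′ d :+′ d :+′ d :+′ d :+′ κ :=′ ((b :+′ d) :+′ (b :+′ d) :+′ κ) :+′ (b :+′ b :+′ d :+′ d)) ≡.refl b d κ) (≡.cong₂ ℕ._+_ N-eq 2a-eq))) ⟩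
    g a * h b + s * q ^ d * h a * g′ (b ℕ.+ b) (b ℕ.+ b ℕ.+ d ℕ.+ d ℕ.+ d ℕ.+ d ℕ.+ κ ℕ.+ κ)
      ≡⟨ ≡.cong (λ x → g a * h b + s * q ^ d * h a * g′ (b ℕ.+ b) x)
           (≡.sym (complement (b ℕ.+ b) (≡.trans
             (solve₂ 3 (λ b d κ → b :+′ b :+′ (b :+′ b :+′ d :+′ d :+′ d :+′ d :+′ κ :+′ κ) :=′ ((b :+′ d) :+′ (b :+′ d) :+′ κ) :+′ ((b :+′ d) :+′ (b :+′ d) :+′ κ)) ≡.refl b d κ)
             (≡.cong₂ ℕ._+_ N-eq N-eq)))) ⟩
    g a * h b + s * q ^ (a ℕ.∸ b) * h a * g b ∎
    where
    open ℕSolver.+-*-Solver using () renaming (solve to solve₂; _:+_ to _:+′_; _:=_ to _:=′_)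
    s = ⟦ Sign.opposite σ ⟧
    d = a ℕ.∸ b
    κ = N ℕ.∸ (a ℕ.+ a)
    g′ : ℕ → ℕ → Carrier
    g′ i j = f cutoff (q ^ i) (q ^ j)
    0<d : 1 ℕ.≤ d
    0<d = ℕ.m<n⇒0<n∸m b<a
    b+d≡a : b ℕ.+ d ≡ a
    b+d≡a = ℕ.m+[n∸m]≡n (ℕ.<⇒≤ b<a)
    2a-eq : b ℕ.+ b ℕ.+ d ℕ.+ d ≡ a ℕ.+ a
    2a-eq = ≡.trans (solve₂ 2 (λ b d → b :+′ b :+′ d :+′ d :=′ (b :+′ d) :+′ (b :+′ d)) ≡.refl b d) (≡.cong₂ ℕ._+_ b+d≡a b+d≡a)
    N-eq : (b ℕ.+ d) ℕ.+ (b ℕ.+ d) ℕ.+ κ ≡ N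
    N-eq = ≡.trans (≡.cong (λ x → x ℕ.+ x ℕ.+ κ) b+d≡a) (ℕ.m+[n∸m]≡n (ℕ.<⇒≤ 2a<N))
    complement : ∀ m {n k} → m ℕ.+ k ≡ n → n ℕ.∸ m ≡ k
    complement m {k = k} eq = ≡.trans (≡.cong (ℕ._∸ m) (≡.sym eq)) (ℕ.m+n∸m≡n m k)
    exponents : ∀ s {i i′ j j′} → i ≡ i′ → j ≡ j′ → f cutoff (s * q ^ i) (s * q ^ j) ≡ f cutoff (s * q ^ i′) (s * q ^ j′)
    exponents s i≡ j≡ = ≡.cong₂ (λ i j → f cutoff (s * q ^ i) (s * q ^ j)) i≡ j≡

  euler-invertible : 1 ℕ.≤ N → Invertible euler
  euler-invertible 1≤N = poch-invertible (q ^ N) cutoff (begin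
    (- (q ^ N)) ^ K       ≈⟨ ^-congˡ K (trans (sym (-1*x≈-x _)) (*-comm _ _)) ⟩
    (q ^ N * - 1#) ^ K    ≈⟨ *-nilpotentˡ (- 1#) (q^-nilpotent 1≤N) ⟩
    0#                    ∎)

  -- The ring solver has no subtraction: s stands for −1.
  plücker : ∀ ga ha gb hb gc hc gd hd k l m s → s + 1# ≈ 0# →
    l * ((ga * hb + s * k * ha * gb) * (gc * hd + s * m * hc * gd))
      + (ga * hd + s * (k * l * m) * ha * gd) * (gb * hc + s * l * hb * gc)
    ≈ (ga * hc + s * (k * l) * ha * gc) * (gb * hd + s * (l * m) * hb * gd)
  plücker ga ha gb hb gc hc gd hd k l m s s+1≈0 = trans
    (solve 12 (λ ga ha gb hb gc hc gd hd k l m s →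
       l :* ((ga :* hb :+ s :* k :* ha :* gb) :* (gc :* hd :+ s :* m :* hc :* gd))
         :+ (ga :* hd :+ s :* (k :* l :* m) :* ha :* gd) :* (gb :* hc :+ s :* l :* hb :* gc)
       := (ga :* hc :+ s :* (k :* l) :* ha :* gc) :* (gb :* hd :+ s :* (l :* m) :* hb :* gd)
         -- Treating `s` as a variable leaves a defect that is a multiple of `s + 1`: the products
         -- `ga hb gc hd` and `ha gb hc gd` cancel only at `s = −1`.
         :+ (s :+ con 1) :* (l :* ga :* hb :* gc :* hd :+ s :* l :* k :* m :* ha :* gb :* hc :* gd))
       refl ga ha gb hb gc hc gd hd k l m s)
    (trans (+-congˡ (trans (*-congʳ s+1≈0) (zeroˡ _))) (+-identityʳ _))

  -- For points `x_i = σ_i q^i`, the minor of the columns `(g, x h)` at `i, j` is `x_j` times the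
  -- determinant above. Dividing the Plücker relation by `x_c x_d` leaves the ratio `x_b / x_c` on
  -- one term. Here `k`, `l`, `m` are the ratios of neighbouring points, and `chain` composes them.
  weierstrass : ∀ σa σb σc σd {a b c d} → 1 ℕ.≤ d → d ℕ.< c → c ℕ.< b → b ℕ.< a → a ℕ.+ a ℕ.< N →
    ⟦ σb Sign.* σc ⟧ * q ^ (b ℕ.∸ c) * (θ² (σa Sign.* σb) a b * θ² (σc Sign.* σd) c d)
      + θ² (σa Sign.* σd) a d * θ² (σb Sign.* σc) b c
    ≈ θ² (σa Sign.* σc) a c * θ² (σb Sign.* σd) b d
  weierstrass σa σb σc σd {a} {b} {c} {d} 1≤d d<c c<b b<a 2a<N =
    invertible-cancel (invertible-* inv² inv²) (begin
      e⁴ * (l * (X σab a b * X σcd c d) + X σad a d * X σbc b c)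
        ≈⟨ solve 6 (λ e l x y z w → e :* e :* (l :* (x :* y) :+ z :* w) := l :* (e :* x :* (e :* y)) :+ e :* z :* (e :* w))
             refl e² l (X σab a b) (X σcd c d) (X σad a d) (X σbc b c) ⟩
      l * (e² * X σab a b * (e² * X σcd c d)) + e² * X σad a d * (e² * X σbc b c)
        ≈⟨ +-cong (*-congˡ (*-cong (minor σab refl (ℕ.<-trans 1≤c c<b) b<a 2a<N) (minor σcd refl 1≤d d<c (2*< (ℕ.<-trans c<b b<a)))))
                  (*-cong (minor σad klm 1≤d (ℕ.<-trans d<c (ℕ.<-trans c<b b<a)) 2a<N) (minor σbc refl 1≤c c<b (2*< b<a))) ⟩
      l * ((g a * h b + s * k * h a * g b) * (g c * h d + s * m * h c * g d))
        + (g a * h d + s * (k * l * m) * h a * g d) * (g b * h c + s * l * h b * g c)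
        ≈⟨ plücker (g a) (h a) (g b) (h b) (g c) (h c) (g d) (h d) k l m s (-‿inverseˡ 1#) ⟩
      (g a * h c + s * (k * l) * h a * g c) * (g b * h d + s * (l * m) * h b * g d)
        ≈⟨ *-cong (minor σac kl 1≤c (ℕ.<-trans c<b b<a) 2a<N) (minor σbd lm 1≤d (ℕ.<-trans d<c c<b) (2*< b<a)) ⟨
      e² * X σac a c * (e² * X σbd b d)
        ≈⟨ solve 3 (λ e x y → e :* x :* (e :* y) := e :* e :* (x :* y)) refl e² (X σac a c) (X σbd b d) ⟩
      e⁴ * (X σac a c * X σbd b d) ∎)
    where
    X = θ²
    e² = euler * euler
    e⁴ = e² * e²
    inv² : Invertible e²
    inv² = invertible-* inv inv
      where inv = euler-invertible (ℕ.≤-trans (s≤s z≤n) 2a<N)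
    s = - 1#
    σab = σa Sign.* σb
    σac = σa Sign.* σc
    σad = σa Sign.* σd
    σbc = σb Sign.* σc
    σbd = σb Sign.* σd
    σcd = σc Sign.* σd
    k = ⟦ σab ⟧ * q ^ (a ℕ.∸ b)
    l = ⟦ σbc ⟧ * q ^ (b ℕ.∸ c)
    m = ⟦ σcd ⟧ * q ^ (c ℕ.∸ d)
    1≤c : 1 ℕ.≤ c
    1≤c = ℕ.≤-trans 1≤d (ℕ.<⇒≤ d<c)
    2*< : ∀ {x} → x ℕ.< a → x ℕ.+ x ℕ.< N
    2*< x<a = ℕ.<-trans (ℕ.+-mono-< x<a x<a) 2a<N
    minor : ∀ σ {x y z} → ⟦ σ ⟧ * q ^ (x ℕ.∸ y) ≈ z → 1 ℕ.≤ y → y ℕ.< x → x ℕ.+ x ℕ.< N →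
            e² * X σ x y ≈ g x * h y + s * z * h x * g y
    minor σ {x} {y} {z} eq 1≤y y<x 2x<N = trans (θ²-determinant σ 1≤y y<x 2x<N)
      (+-congˡ (*-congʳ (*-congʳ (trans (*-congʳ (opposite-⟦⟧ σ)) (trans (*-assoc _ _ _) (*-congˡ eq))))))
    chain : ∀ σ τ υ {x y z} → z ℕ.≤ y → y ℕ.≤ x →
            ⟦ σ Sign.* υ ⟧ * q ^ (x ℕ.∸ z) ≈ ⟦ σ Sign.* τ ⟧ * q ^ (x ℕ.∸ y) * (⟦ τ Sign.* υ ⟧ * q ^ (y ℕ.∸ z))
    chain σ τ υ {x} {y} {z} z≤y y≤x = begin
      ⟦ σ Sign.* υ ⟧ * q ^ (x ℕ.∸ z)
        ≈⟨ *-cong (trans (reflexive (≡.cong ⟦_⟧ (signs σ τ υ))) (⟦⟧-homo (σ Sign.* τ) (τ Sign.* υ)))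
                  (trans (^-congʳ q differences) (^-homo-* q (x ℕ.∸ y) (y ℕ.∸ z))) ⟩
      ⟦ σ Sign.* τ ⟧ * ⟦ τ Sign.* υ ⟧ * (q ^ (x ℕ.∸ y) * q ^ (y ℕ.∸ z))
        ≈⟨ solve 4 (λ a b c d → a :* b :* (c :* d) := a :* c :* (b :* d)) refl _ _ _ _ ⟩
      ⟦ σ Sign.* τ ⟧ * q ^ (x ℕ.∸ y) * (⟦ τ Sign.* υ ⟧ * q ^ (y ℕ.∸ z)) ∎
      where
      signs : ∀ σ τ υ → σ Sign.* υ ≡ σ Sign.* τ Sign.* (τ Sign.* υ)
      signs Sign.+ Sign.+ υ      = ≡.refl
      signs Sign.- Sign.+ υ      = ≡.refl
      signs Sign.+ Sign.- Sign.+ = ≡.refl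
      signs Sign.+ Sign.- Sign.- = ≡.refl
      signs Sign.- Sign.- υ      = ≡.refl
      differences : x ℕ.∸ z ≡ (x ℕ.∸ y) ℕ.+ (y ℕ.∸ z)
      differences = ≡.trans (≡.cong (ℕ._∸ z) (≡.sym (ℕ.m∸n+n≡m y≤x))) (ℕ.+-∸-assoc (x ℕ.∸ y) z≤y)
    kl : ⟦ σac ⟧ * q ^ (a ℕ.∸ c) ≈ k * l
    kl = chain σa σb σc (ℕ.<⇒≤ c<b) (ℕ.<⇒≤ b<a)
    lm : ⟦ σbd ⟧ * q ^ (b ℕ.∸ d) ≈ l * m
    lm = chain σb σc σd (ℕ.<⇒≤ d<c) (ℕ.<⇒≤ c<b)
    klm : ⟦ σad ⟧ * q ^ (a ℕ.∸ d) ≈ k * l * m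
    klm = trans (chain σa σc σd (ℕ.<⇒≤ d<c) (ℕ.<⇒≤ (ℕ.<-trans c<b b<a))) (*-congʳ kl)

-- Power series over ℤ modulo a power of q

module PowerSeries where
  open Sums ℤ.+-*-commutativeRing public using (antidiagonal; antidiagonal-cong; antidiagonal-+; antidiagonal-*ˡ; antidiagonal-last)
  open ≡.≡-Reasoning

  Series : Set
  Series = ℕ → ℤ

  0ₛ 1ₛ qₛ : Series
  0ₛ _ = + 0
  1ₛ zero    = + 1
  1ₛ (suc _) = + 0
  qₛ zero    = + 0
  qₛ (suc n) = 1ₛ n

  infixl 7 _⊛_
  infixl 6 _⊕_
  _⊕_ _⊛_ : Series → Series → Series
  (f ⊕ g) n = f n ℤ.+ g n
  (f ⊛ g) n = antidiagonal (λ i j → f i ℤ.* g j) n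

  tail : Series → Series
  tail f n = f (suc n)

  ⊛-comm : ∀ f g n → (f ⊛ g) n ≡ (g ⊛ f) n
  ⊛-comm f g zero    = ℤ.*-comm (f 0) (g 0)
  ⊛-comm f g (suc n) = begin
    f 0 ℤ.* g (suc n) ℤ.+ (tail f ⊛ g) n    ≡⟨ ≡.cong₂ ℤ._+_ (ℤ.*-comm (f 0) (g (suc n))) (⊛-comm (tail f) g n) ⟩
    g (suc n) ℤ.* f 0 ℤ.+ (g ⊛ tail f) n    ≡⟨ ℤ.+-comm (g (suc n) ℤ.* f 0) _ ⟩
    (g ⊛ tail f) n ℤ.+ g (suc n) ℤ.* f 0    ≡⟨ antidiagonal-last (λ i j → g i ℤ.* f j) n ⟨
    (g ⊛ f) (suc n)                         ∎

  ⊛-distribʳ : ∀ f g h n → ((g ⊕ h) ⊛ f) n ≡ (g ⊛ f ⊕ h ⊛ f) n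
  ⊛-distribʳ f g h n = ≡.trans (antidiagonal-cong n (λ i j _ → ℤ.*-distribʳ-+ (f j) (g i) (h i)))
    (antidiagonal-+ (λ i j → g i ℤ.* f j) (λ i j → h i ℤ.* f j) n)

  -- Induction on the coefficient, using that `tail (f ⊛ g)` is by definition `f 0` times `tail g`
  -- plus `tail f ⊛ g`.
  ⊛-assoc : ∀ f g h n → ((f ⊛ g) ⊛ h) n ≡ (f ⊛ (g ⊛ h)) n
  ⊛-assoc f g h zero    = ℤ.*-assoc (f 0) (g 0) (h 0)
  ⊛-assoc f g h (suc n) = begin
    f 0 ℤ.* g 0 ℤ.* h (suc n) ℤ.+ (tail (f ⊛ g) ⊛ h) n
      ≡⟨ ≡.cong₂ ℤ._+_ (ℤ.*-assoc (f 0) (g 0) (h (suc n))) (⊛-distribʳ h (λ i → f 0 ℤ.* g (suc i)) (tail f ⊛ g) n) ⟩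
    f 0 ℤ.* (g 0 ℤ.* h (suc n)) ℤ.+ (((λ i → f 0 ℤ.* g (suc i)) ⊛ h) n ℤ.+ (tail f ⊛ g ⊛ h) n)
      ≡⟨ ≡.cong₂ (λ x y → f 0 ℤ.* (g 0 ℤ.* h (suc n)) ℤ.+ (x ℤ.+ y))
           (≡.trans (antidiagonal-cong n (λ i j _ → ℤ.*-assoc (f 0) (g (suc i)) (h j)))
                    (≡.sym (antidiagonal-*ˡ (f 0) (λ i j → g (suc i) ℤ.* h j) n)))
           (⊛-assoc (tail f) g h n) ⟩
    f 0 ℤ.* (g 0 ℤ.* h (suc n)) ℤ.+ (f 0 ℤ.* (tail g ⊛ h) n ℤ.+ (tail f ⊛ (g ⊛ h)) n)
      ≡⟨ ℤ.+-assoc (f 0 ℤ.* (g 0 ℤ.* h (suc n))) _ _ ⟨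
    f 0 ℤ.* (g 0 ℤ.* h (suc n)) ℤ.+ f 0 ℤ.* (tail g ⊛ h) n ℤ.+ (tail f ⊛ (g ⊛ h)) n
      ≡⟨ ≡.cong (ℤ._+ (tail f ⊛ (g ⊛ h)) n) (ℤ.*-distribˡ-+ (f 0) (g 0 ℤ.* h (suc n)) ((tail g ⊛ h) n)) ⟨
    f 0 ℤ.* (g ⊛ h) (suc n) ℤ.+ (tail f ⊛ (g ⊛ h)) n ∎

  ⊛-zeroˡ : ∀ f n → (0ₛ ⊛ f) n ≡ + 0
  ⊛-zeroˡ f zero    = ≡.refl
  ⊛-zeroˡ f (suc n) = ≡.trans (ℤ.+-identityˡ _) (⊛-zeroˡ f n)

  ⊛-identityˡ : ∀ f n → (1ₛ ⊛ f) n ≡ f n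
  ⊛-identityˡ f zero    = ℤ.*-identityˡ (f 0)
  ⊛-identityˡ f (suc n) = begin
    + 1 ℤ.* f (suc n) ℤ.+ (0ₛ ⊛ f) n   ≡⟨ ≡.cong₂ ℤ._+_ (ℤ.*-identityˡ (f (suc n))) (⊛-zeroˡ f n) ⟩
    f (suc n) ℤ.+ + 0                  ≡⟨ ℤ.+-identityʳ _ ⟩
    f (suc n)                          ∎

  q⊛-suc : ∀ f n → (qₛ ⊛ f) (suc n) ≡ f n
  q⊛-suc f n = ≡.trans (ℤ.+-identityˡ _) (⊛-identityˡ f n)

  -- The ring ℤ[[q]] / (q^K).
  module Truncated (K : ℕ) where
    infix 4 _≈ₛ_
    -- The quotient is taken in the equality: only coefficients below `K` are compared. A record
    -- keeps `f` and `g` inferable from the type of a proof.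
    record _≈ₛ_ (f g : Series) : Set where
      constructor agree
      field coefficient : ∀ n → n ℕ.< K → f n ≡ g n
    open _≈ₛ_ public

    pointwise : ∀ {f g : Series} → (∀ n → f n ≡ g n) → f ≈ₛ g
    pointwise eq = agree λ n _ → eq n

    ⊛-cong : ∀ {f f′ g g′} → f ≈ₛ f′ → g ≈ₛ g′ → f ⊛ g ≈ₛ f′ ⊛ g′
    ⊛-cong f≈ g≈ = agree λ n n<K → antidiagonal-cong n λ i j i+j≡n → ≡.cong₂ ℤ._*_
      (coefficient f≈ i (ℕ.≤-<-trans (ℕ.≤-trans (ℕ.m≤m+n i j) (ℕ.≤-reflexive i+j≡n)) n<K))
      (coefficient g≈ j (ℕ.≤-<-trans (ℕ.≤-trans (ℕ.m≤n+m j i) (ℕ.≤-reflexive i+j≡n)) n<K))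

    ring : CommutativeRing _ _
    ring = record
      { Carrier = Series
      ; _≈_ = _≈ₛ_
      ; _+_ = _⊕_
      ; _*_ = _⊛_
      ; -_ = λ f n → ℤ.- f n
      ; 0# = 0ₛ
      ; 1# = 1ₛ
      ; isCommutativeRing = record
        { isRing = record
          { +-isAbelianGroup = record
            { isGroup = record
              { isMonoid = record
                { isSemigroup = record
                  { isMagma = record
                    { isEquivalence = record
                      { refl = pointwise λ _ → ≡.refl
                      ; sym = λ f≈g → agree λ n n<K → ≡.sym (coefficient f≈g n n<K)
                      ; trans = λ f≈g g≈h → agree λ n n<K → ≡.trans (coefficient f≈g n n<K) (coefficient g≈h n n<K)
                      }
                    ; ∙-cong = λ f≈ g≈ → agree λ n n<K → ≡.cong₂ ℤ._+_ (coefficient f≈ n n<K) (coefficient g≈ n n<K)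
                    }
                  ; assoc = λ f g h → pointwise λ n → ℤ.+-assoc (f n) (g n) (h n)
                  }
                ; identity = (λ f → pointwise λ n → ℤ.+-identityˡ (f n)) , (λ f → pointwise λ n → ℤ.+-identityʳ (f n))
                }
              ; inverse = (λ f → pointwise λ n → ℤ.+-inverseˡ (f n)) , (λ f → pointwise λ n → ℤ.+-inverseʳ (f n))
              ; ⁻¹-cong = λ f≈ → agree λ n n<K → ≡.cong ℤ.-_ (coefficient f≈ n n<K)
              }
            ; comm = λ f g → pointwise λ n → ℤ.+-comm (f n) (g n)
            }
          ; *-cong = ⊛-cong
          ; *-assoc = λ f g h → pointwise (⊛-assoc f g h)
          ; *-identity = (λ f → pointwise (⊛-identityˡ f)) , (λ f → pointwise (λ n → ≡.trans (⊛-comm f 1ₛ n) (⊛-identityˡ f n)))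
          ; distrib = (λ f g h → pointwise (λ n → ≡.trans (⊛-comm f (g ⊕ h) n)
                        (≡.trans (⊛-distribʳ f g h n) (≡.cong₂ ℤ._+_ (⊛-comm g f n) (⊛-comm h f n)))))
                    , (λ f g h → pointwise (⊛-distribʳ f g h))
          }
        ; *-comm = λ f g → pointwise (⊛-comm f g)
        }
      }

    open SemiringExp (CommutativeRing.semiring ring) public using (_^_)

    q^⊛-+ : ∀ m f n → (qₛ ^ m ⊛ f) (m ℕ.+ n) ≡ f n
    q^⊛-+ zero    f n = ⊛-identityˡ f n
    q^⊛-+ (suc m) f n = ≡.trans (⊛-assoc qₛ (qₛ ^ m) f (suc m ℕ.+ n)) (≡.trans (q⊛-suc (qₛ ^ m ⊛ f) (m ℕ.+ n)) (q^⊛-+ m f n))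

    q^⊛-< : ∀ m f n → n ℕ.< m → (qₛ ^ m ⊛ f) n ≡ + 0
    q^⊛-< (suc m) f zero    _         = ⊛-assoc qₛ (qₛ ^ m) f 0
    q^⊛-< (suc m) f (suc n) (s≤s n<m) = ≡.trans (⊛-assoc qₛ (qₛ ^ m) f (suc n)) (≡.trans (q⊛-suc (qₛ ^ m ⊛ f) n) (q^⊛-< m f n n<m))

    q^K≈0 : qₛ ^ K ≈ₛ 0ₛ
    q^K≈0 = agree λ n n<K → ≡.trans (≡.sym (⊛-identityˡ (qₛ ^ K) n)) (≡.trans (⊛-comm 1ₛ (qₛ ^ K) n) (q^⊛-< K 1ₛ n n<K))

-- Euler products and generating functions of partitions

module EulerProduct {c ℓ : Level} (R : CommutativeRing c ℓ) (q : CommutativeRing.Carrier R) where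
  open CommutativeRing R hiding (zero)
  open SemiringExp semiring using (_^_)
  open NaturalSolver commutativeSemiring using (solve; _:*_; _:=_)

  product : (ℕ → Carrier) → ℕ → Carrier
  product F zero    = 1#
  product F (suc n) = product F n * F n

  product-cong : ∀ {F G : ℕ → Carrier} n → (∀ j → F j ≈ G j) → product F n ≈ product G n
  product-cong zero    eq = refl
  product-cong (suc n) eq = *-cong (product-cong n eq) (eq n)

  product-1 : ∀ F n → (∀ j → F j ≈ 1#) → product F n ≈ 1#
  product-1 F zero    eq = refl
  product-1 F (suc n) eq = trans (*-cong (product-1 F n eq) (eq n)) (*-identityˡ 1#)

  product-* : ∀ F G n → product (λ j → F j * G j) n ≈ product F n * product G n
  product-* F G zero    = sym (*-identityˡ 1#)
  product-* F G (suc n) = trans (*-congʳ (product-* F G n))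
    (solve 4 (λ x y z w → x :* y :* (z :* w) := x :* z :* (y :* w)) refl _ _ _ _)

  product-+ : ∀ F m n → product F (m ℕ.+ n) ≈ product F m * product (λ j → F (m ℕ.+ j)) n
  product-+ F m zero    rewrite ℕ.+-identityʳ m = sym (*-identityʳ _)
  product-+ F m (suc n) rewrite ℕ.+-suc m n = trans (*-congʳ (product-+ F m n)) (*-assoc _ _ _)

  module _ (S : PosSet) where
    factor : ℕ → Carrier
    factor j = if S j then 1# + - 1# * q ^ j else 1#

    denominator : ℕ → Carrier
    denominator = product (λ j → factor (suc j))

module PartitionCounting where
  open PowerSeries

  count : PosSet → List (List ℕ) → ℕ
  count S λs = length (filter (λ λ′ → all S λ′ ≟B true) λs)

  count-++ : ∀ S xs ys → count S (xs ++ ys) ≡ count S xs ℕ.+ count S ys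
  count-++ S xs ys = ≡.trans (≡.cong length (filter-++ (λ λ′ → all S λ′ ≟B true) xs ys)) (length-++ (filter _ xs))

  count-map : ∀ S k xs → count S (map (k ∷_) xs) ≡ (if S k then count S xs else 0)
  count-map S k [] with S k
  ... | true  = ≡.refl
  ... | false = ≡.refl
  count-map S k (x ∷ xs) with S k | count-map S k xs
  ... | false | ih = ih
  ... | true  | ih with all S x
  ...   | true  = ≡.cong suc ih
  ...   | false = ih

  -- The recursion may hand down more fuel than the remaining sum, whereas `restricted` takes
  -- exactly the sum as fuel.
  parts-fuel : ∀ f f′ k n → n ℕ.≤ f → n ℕ.≤ f′ → parts f k n ≡ parts f′ k n
  partsFrom-fuel : ∀ f f′ k n → n ℕ.≤ f → n ℕ.≤ f′ → partsFrom f k (suc n) ≡ partsFrom f′ k (suc n)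
  parts-fuel f f′ k zero n≤f n≤f′ = ≡.refl
  parts-fuel (suc f) (suc f′) k (suc n) (s≤s n≤f) (s≤s n≤f′) = partsFrom-fuel f f′ k n n≤f n≤f′
  partsFrom-fuel f f′ zero    n n≤f n≤f′ = ≡.refl
  partsFrom-fuel f f′ (suc j) n n≤f n≤f′ = ≡.cong₂ (λ xs ys → (if suc j ℕ.≤ᵇ suc n then map (suc j ∷_) xs else []) ++ ys)
    (parts-fuel f f′ (suc j) (n ℕ.∸ j) (ℕ.≤-trans (ℕ.m∸n≤m n j) n≤f) (ℕ.≤-trans (ℕ.m∸n≤m n j) n≤f′))
    (partsFrom-fuel f f′ j n n≤f n≤f′)

  restricted : PosSet → ℕ → ℕ → ℕ
  restricted S k n = count S (parts n k n)

  -- Either no part equals `suc k`, or one copy of this largest part is removed and the rest is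
  -- again bounded by `suc k`.
  restricted-suc : ∀ S k n → restricted S (suc k) n
    ≡ restricted S k n ℕ.+ (if (suc k ℕ.≤ᵇ n) then (if S (suc k) then restricted S (suc k) (n ℕ.∸ suc k) else 0) else 0)
  restricted-suc S k zero    = ≡.refl
  restricted-suc S k (suc n) = ≡.trans (count-++ S (if suc k ℕ.≤ᵇ suc n then map (suc k ∷_) (parts n (suc k) (n ℕ.∸ k)) else []) (partsFrom n k (suc n)))
    (≡.trans (ℕ.+-comm _ (restricted S k (suc n))) (≡.cong (restricted S k (suc n) ℕ.+_) largest))
    where
    largest : count S (if suc k ℕ.≤ᵇ suc n then map (suc k ∷_) (parts n (suc k) (n ℕ.∸ k)) else [])
              ≡ (if suc k ℕ.≤ᵇ suc n then (if S (suc k) then restricted S (suc k) (n ℕ.∸ k) else 0) else 0)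
    largest with suc k ℕ.≤ᵇ suc n
    ... | false = ≡.refl
    ... | true  = ≡.trans (count-map S (suc k) (parts n (suc k) (n ℕ.∸ k)))
      (≡.cong (λ xs → if S (suc k) then count S xs else 0) (parts-fuel n (n ℕ.∸ k) (suc k) (n ℕ.∸ k) (ℕ.m∸n≤m n k) ℕ.≤-refl))

  p≡restricted : ∀ S {k n} → n ℕ.≤ k → p S n ≡ restricted S k n
  p≡restricted S {k} {n} n≤k = go (ℕ.≤⇒≤′ n≤k)
    where
    go : ∀ {k} → n ℕ.≤′ k → p S n ≡ restricted S k n
    go (ℕ.≤′-reflexive ≡.refl) = ≡.refl
    go (ℕ.≤′-step {k} n≤′k)    with suc k ℕ.≤ᵇ n in eq | restricted-suc S k n
    ... | false | step = ≡.trans (go n≤′k) (≡.sym (≡.trans step (ℕ.+-identityʳ _)))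
    ... | true  | step = contradiction (ℕ.≤ᵇ⇒≤ (suc k) n (≡.subst T (≡.sym eq) _)) (ℕ.≤⇒≯ (ℕ.≤′⇒≤ n≤′k))

  module _ (K : ℕ) (S : PosSet) where
    open Truncated K
    open CommutativeRing ring hiding (zero; ring)
    open NaturalSolver commutativeSemiring using (solve; _:+_; _:*_; con; _:=_)
    open EulerProduct ring qₛ using (factor; denominator)
    open SetoidReasoning setoid

    generating : ℕ → Series
    generating k n = + restricted S k n

    generating-suc : ∀ k n → generating (suc k) n ≡ (generating k + (if S (suc k) then qₛ ^ suc k * generating (suc k) else 0#)) n
    generating-suc k n = ≡.trans (≡.cong +_ (restricted-suc S k n)) (≡.cong (λ x → + restricted S k n ℤ.+ x) largest)
      where
      largest : + (if (suc k ℕ.≤ᵇ n) then (if S (suc k) then restricted S (suc k) (n ℕ.∸ suc k) else 0) else 0)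
                ≡ (if S (suc k) then qₛ ^ suc k * generating (suc k) else 0#) n
      largest with S (suc k) | suc k ℕ.≤ᵇ n in eq
      ... | false | false = ≡.refl
      ... | false | true  = ≡.refl
      ... | true  | false = ≡.sym (q^⊛-< (suc k) (generating (suc k)) n (ℕ.≰⇒> λ k<n → ≡.subst T eq (ℕ.≤⇒≤ᵇ k<n)))
      ... | true  | true  = ≡.trans (≡.sym (q^⊛-+ (suc k) (generating (suc k)) (n ℕ.∸ suc k)))
        (≡.cong (qₛ ^ suc k * generating (suc k)) (ℕ.m+[n∸m]≡n (ℕ.≤ᵇ⇒≤ (suc k) n (≡.subst T (≡.sym eq) _))))

    -- `generating-suc` has the same series on both sides, `G = generating k + q^(k+1) G` when
    -- `suc k` is in `S`; collecting `G` produces the factor `1 − q^(k+1)`.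
    generating-factor : ∀ k → generating (suc k) * factor S (suc k) ≈ generating k
    generating-factor k with S (suc k) | generating-suc k
    ... | false | step = trans (*-identityʳ _)
      (pointwise (λ n → ≡.trans (step n) (ℤ.+-identityʳ _)))
    ... | true  | step = begin
      G * (1# + - 1# * x)
        ≈⟨ solve 3 (λ g m x → g :* (con 1 :+ m :* x) := g :+ m :* (x :* g)) refl G (- 1#) x ⟩
      G + - 1# * (x * G)
        ≈⟨ +-congʳ (pointwise step) ⟩
      generating k + x * G + - 1# * (x * G)
        ≈⟨ solve 3 (λ g m y → g :+ y :+ m :* y := g :+ (m :+ con 1) :* y) refl (generating k) (- 1#) (x * G) ⟩
      generating k + (- 1# + 1#) * (x * G)
        ≈⟨ +-cong (refl {generating k}) (trans (*-congʳ {x * G} (-‿inverseˡ 1#)) (zeroˡ (x * G))) ⟩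
      generating k + 0#
        ≈⟨ +-identityʳ (generating k) ⟩
      generating k ∎
      where
      G = generating (suc k)
      x = qₛ ^ suc k

    generating-denominator : ∀ k → generating k * denominator S k ≈ 1#
    generating-denominator zero    = trans (*-identityʳ (generating 0)) (pointwise one)
      where
      one : ∀ n → generating 0 n ≡ 1ₛ n
      one zero    = ≡.refl
      one (suc n) = ≡.refl
    generating-denominator (suc k) = begin
      generating (suc k) * (denominator S k * factor S (suc k))
        ≈⟨ solve 3 (λ g d f → g :* (d :* f) := g :* f :* d) refl (generating (suc k)) (denominator S k) (factor S (suc k)) ⟩
      generating (suc k) * factor S (suc k) * denominator S k
        ≈⟨ *-congʳ (generating-factor k) ⟩
      generating k * denominator S k
        ≈⟨ generating-denominator k ⟩
      1# ∎

-- Monomials of residue products and periodic sets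

-- (q^e; q^30)_∞ (q^(30 − e); q^30)_∞ is the product of (q^r; q^60)_∞ over these r.
doubled : ℕ → List ℕ
doubled e = e ∷ e ℕ.+ 30 ∷ 30 ℕ.∸ e ∷ (30 ℕ.∸ e) ℕ.+ 30 ∷ []

-- For sign -, `(−x; p)_∞ = (x²; p²)_∞ / (x; p)_∞` with `p = q^30`: the doubled exponents go into
-- the numerator, and the residues of the corresponding positive theta into the denominator.
numerators denominators : List (Sign × ℕ) → List ℕ
numerators []                   = []
numerators ((Sign.+ , e) ∷ es)  = doubled e ++ numerators es
numerators ((Sign.- , e) ∷ es)  = e ℕ.+ e ∷ (30 ℕ.∸ e) ℕ.+ (30 ℕ.∸ e) ∷ numerators es
denominators []                 = []
denominators ((Sign.+ , e) ∷ es) = denominators es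
denominators ((Sign.- , e) ∷ es) = doubled e ++ denominators es

cleared : (A B C : List (Sign × ℕ)) → List ℕ
cleared A B C = numerators A ++ denominators B ++ denominators C

-- Numerators and denominators are monomials in the (q^r; q^60)_∞, stored as lists of r.
-- Clearing denominators in Y = q^s X + Z gives y = q^s x + z, and D_T = q^s D_S + D_S D_T
-- follows on cancelling y once x D_T = y D_S and z = y D_S as monomials.
record Certificate (X Y Z : List (Sign × ℕ)) (S T : List ℕ) : Set where
  constructor certificate
  field
    balance₁ : sort (cleared X Y Z ++ T) ≡ sort (cleared Y X Z ++ S)
    balance₂ : sort (cleared Z X Y) ≡ sort (cleared Y X Z ++ S)
    positive : True (all? (1 ℕ.≤?_) (cleared Y X Z))
open Certificate

pairing : (σa σb σc σd : Sign) (a b c d : ℕ) → List (Sign × ℕ)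
pairing σa σb σc σd a b c d =
  (σa Sign.* σb , a ℕ.+ b) ∷ (σa Sign.* σb , a ℕ.∸ b) ∷ (σc Sign.* σd , c ℕ.+ d) ∷ (σc Sign.* σd , c ℕ.∸ d) ∷ []

-- Stated for positive arguments only: 0 never belongs to a `pmSet`, so the class of 0 is
-- represented by 60, as it is in `classes S 60`.
Periodic : PosSet → Set
Periodic S = ∀ i r → S (suc (i ℕ.* 60 ℕ.+ r)) ≡ S (suc r)

pmSet-periodic : ∀ rs → Periodic (pmSet 60 rs)
pmSet-periodic rs i r = ≡.cong or (map-cong residue rs)
  where
  shift : ∀ m → (suc (i ℕ.* 60 ℕ.+ r) ℕ.+ m) ℕ.% 60 ≡ (suc r ℕ.+ m) ℕ.% 60
  shift m = ≡.trans (≡.cong (ℕ._% 60) (ℕSolver.+-*-Solver.solve 3 (λ x r m → con 1 :+ (x :+ r) :+ m := (con 1 :+ r :+ m) :+ x) ≡.refl (i ℕ.* 60) r m))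
                    ([m+kn]%n≡m%n (suc r ℕ.+ m) i 60)
    where open ℕSolver.+-*-Solver
  shift₀ : suc (i ℕ.* 60 ℕ.+ r) ℕ.% 60 ≡ suc r ℕ.% 60
  shift₀ = ≡.trans (≡.cong (λ m → suc m ℕ.% 60) (ℕ.+-comm (i ℕ.* 60) r)) ([m+kn]%n≡m%n (suc r) i 60)
  residue : ∀ t → (suc (i ℕ.* 60 ℕ.+ r) ℕ.% 60 ℕ.≡ᵇ t ℕ.% 60) ∨ ((suc (i ℕ.* 60 ℕ.+ r) ℕ.+ t) ℕ.% 60 ℕ.≡ᵇ 0)
            ≡ (suc r ℕ.% 60 ℕ.≡ᵇ t ℕ.% 60) ∨ ((suc r ℕ.+ t) ℕ.% 60 ℕ.≡ᵇ 0)
  residue t = ≡.cong₂ (λ x y → (x ℕ.≡ᵇ t ℕ.% 60) ∨ (y ℕ.≡ᵇ 0)) shift₀ (shift t)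

classes : PosSet → ℕ → List ℕ
classes S zero    = []
classes S (suc m) = if S (suc m) then suc m ∷ classes S m else classes S m


-- Theta products and Euler products sorted by residue modulo 60

module ResidueProducts {c ℓ : Level} (R : CommutativeRing c ℓ) (K : ℕ) (q : CommutativeRing.Carrier R)
  (q^K≈0 : CommutativeRing._≈_ R (SemiringExp._^_ (CommutativeRing.semiring R) q K) (CommutativeRing.0# R))
  (L : ℕ) (K≤L : K ℕ.≤ L) where
  open CommutativeRing R hiding (zero)
  open JacobiTripleProduct R
  open Nilpotent R K
  open ThetaProducts R K q q^K≈0 using (q^-nilpotent)
  open Weierstrass R K q q^K≈0 L K≤L 30 public
  open NaturalSolver commutativeSemiring using (solve; _:+_; _:*_; con; _:=_)
  open SemiringExp semiring using (_^_; ^-homo-*; ^-assocʳ)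
  open CommutativeSemiringExp commutativeSemiring using (^-distrib-*)
  open SetoidReasoning setoid

  poch-split : ∀ a p n → poch a p (n ℕ.+ n) ≈ poch a (p * p) n * poch (a * p) (p * p) n
  poch-split a p zero    = sym (*-identityˡ 1#)
  poch-split a p (suc n) = begin
    poch a p (suc n ℕ.+ suc n)
      ≡⟨ ≡.cong (λ m → poch a p (suc m)) (ℕ.+-suc n n) ⟩
    poch a p (n ℕ.+ n) * (1# + a * p ^ (n ℕ.+ n)) * (1# + a * (p * p ^ (n ℕ.+ n)))
      ≈⟨ *-cong (*-cong (poch-split a p n) (+-congˡ (*-congˡ pⁿpⁿ))) (+-congˡ (trans (*-congˡ (*-congˡ pⁿpⁿ)) (sym (*-assoc _ _ _)))) ⟩
    poch a (p * p) n * poch (a * p) (p * p) n * (1# + a * (p * p) ^ n) * (1# + a * p * (p * p) ^ n)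
      ≈⟨ solve 4 (λ x y z w → x :* y :* z :* w := x :* z :* (y :* w)) refl _ _ _ _ ⟩
    poch a (p * p) (suc n) * poch (a * p) (p * p) (suc n) ∎
    where
    pⁿpⁿ : p ^ (n ℕ.+ n) ≈ (p * p) ^ n
    pⁿpⁿ = trans (^-homo-* p n n) (sym (^-distrib-* p p n))

  -- Factor by factor this is `(1 + z) (1 − z) = 1 − z²`.
  poch-± : ∀ a p n → poch a p n * poch (- 1# * a) p n ≈ poch (- 1# * (a * a)) (p * p) n
  poch-± a p zero    = *-identityˡ 1#
  poch-± a p (suc n) = begin
    poch a p n * (1# + a * x) * (poch (- 1# * a) p n * (1# + - 1# * a * x))
      ≈⟨ solve 5 (λ y z a x m → y :* (con 1 :+ a :* x) :* (z :* (con 1 :+ m :* a :* x))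
           := y :* z :* ((con 1 :+ m :* (a :* a) :* (x :* x)) :+ (m :+ con 1) :* (a :* x))) refl _ _ a x (- 1#) ⟩
    poch a p n * poch (- 1# * a) p n * ((1# + - 1# * (a * a) * (x * x)) + (- 1# + 1#) * (a * x))
      ≈⟨ *-cong (poch-± a p n) (trans (+-cong (+-congˡ (*-congˡ (sym (^-distrib-* p p n)))) (trans (*-congʳ (-‿inverseˡ 1#)) (zeroˡ _))) (+-identityʳ _)) ⟩
    poch (- 1# * (a * a)) (p * p) n * (1# + - 1# * (a * a) * (p * p) ^ n) ∎
    where x = p ^ n

  -- φ r = (q^r; q^60)_∞
  φ : ℕ → Carrier
  φ r = poch (- 1# * q ^ r) (q ^ 60) L

  ev : List ℕ → Carrier
  ev []       = 1#
  ev (r ∷ rs) = φ r * ev rs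

  ev-++ : ∀ rs ts → ev (rs ++ ts) ≈ ev rs * ev ts
  ev-++ []       ts = sym (*-identityˡ _)
  ev-++ (r ∷ rs) ts = trans (*-congˡ (ev-++ rs ts)) (sym (*-assoc _ _ _))

  ev-↭ : ∀ {rs ts} → rs ↭ ts → ev rs ≈ ev ts
  ev-↭ ↭.refl         = refl
  ev-↭ (↭.prep r p)   = *-congˡ (ev-↭ p)
  ev-↭ (↭.swap r t p) = trans (solve 3 (λ x y z → x :* (y :* z) := y :* (x :* z)) refl _ _ _) (*-congˡ (*-congˡ (ev-↭ p)))
  ev-↭ (↭.trans p p′) = trans (ev-↭ p) (ev-↭ p′)

  -- Sorting gives multisets a normal form, so that a permutation of long residue lists can be
  -- verified by `refl`.
  ev-sort : ∀ {rs ts} → sort rs ≡ sort ts → ev rs ≈ ev ts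
  ev-sort {rs} {ts} eq = trans (ev-↭ (↭.↭-sym (sort-↭ rs))) (trans (reflexive (≡.cong ev eq)) (ev-↭ (sort-↭ ts)))

  -- A positive residue makes `q ^ r` nilpotent; residue 0 would contribute the factor `1 − 1`.
  ev-invertible : ∀ {rs} → All (1 ℕ.≤_) rs → Invertible (ev rs)
  ev-invertible []           = 1# , *-identityˡ 1#
  ev-invertible (1≤r ∷ 1≤rs) =
    invertible-* (poch-invertible (q ^ 60) L (*-nilpotentʳ (- 1#) (q^-nilpotent 1≤r))) (ev-invertible 1≤rs)

  half⁺ : ∀ e → poch (- 1# * q ^ e) (q ^ 30) cutoff ≈ φ e * φ (e ℕ.+ 30)
  half⁺ e = trans (poch-split _ _ L) (*-cong (poch-cong L refl p≈)
    (poch-cong L (trans (*-assoc _ _ _) (*-congˡ (sym (^-homo-* q e 30)))) p≈))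
    where
    p≈ : q ^ 30 * q ^ 30 ≈ q ^ 60
    p≈ = sym (^-homo-* q 30 30)

  half⁻ : ∀ e → poch (1# * q ^ e) (q ^ 30) cutoff * poch (- 1# * q ^ e) (q ^ 30) cutoff ≈ φ (e ℕ.+ e)
  half⁻ e = begin
    poch (1# * q ^ e) (q ^ 30) cutoff * poch (- 1# * q ^ e) (q ^ 30) cutoff
      ≈⟨ *-cong (poch-cong cutoff (*-identityˡ _) refl) refl ⟩
    poch (q ^ e) (q ^ 30) cutoff * poch (- 1# * q ^ e) (q ^ 30) cutoff
      ≈⟨ poch-± (q ^ e) (q ^ 30) cutoff ⟩
    poch (- 1# * (q ^ e * q ^ e)) (q ^ 30 * q ^ 30) cutoff
      ≈⟨ poch-cong cutoff (*-congˡ (sym (^-homo-* q e e))) (sym (^-homo-* q 30 30)) ⟩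
    poch (- 1# * q ^ (e ℕ.+ e)) (q ^ 60) cutoff
      -- Pairing opposite signs keeps `L + L` factors while `φ` has `L`; both numbers are at least
      -- `K`, so both products are stable.
      ≈⟨ poch-stable _ q^60 (ℕ.≤-trans K≤L (ℕ.m≤m+n L L)) ⟩
    poch (- 1# * q ^ (e ℕ.+ e)) (q ^ 60) K
      ≈⟨ poch-stable _ q^60 K≤L ⟨
    φ (e ℕ.+ e) ∎
    where
    q^60 : (q ^ 60) ^ K ≈ 0#
    q^60 = q^-nilpotent {60} (s≤s z≤n)

  open EulerProduct R q

  -- Each further block of 60 consecutive exponents contributes exactly one new factor to the
  -- product of every residue class in `S`.
  classes-block : ∀ S → Periodic S → ∀ i →
    product (λ j → factor S (suc j)) (i ℕ.* 60)
    ≈ product (λ r → if S (suc r) then poch (- 1# * q ^ suc r) (q ^ 60) i else 1#) 60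
  classes-block S periodic zero    = sym (product-1 _ 60 λ r → if-1 (S (suc r)))
    where
    if-1 : ∀ b → (if b then 1# else 1#) ≈ 1#
    if-1 true  = refl
    if-1 false = refl
  classes-block S periodic (suc i) = begin
    product F (60 ℕ.+ i ℕ.* 60)
      ≡⟨ ≡.cong (product F) (ℕ.+-comm 60 (i ℕ.* 60)) ⟩
    product F (i ℕ.* 60 ℕ.+ 60)
      ≈⟨ product-+ F (i ℕ.* 60) 60 ⟩
    product F (i ℕ.* 60) * product (λ r → F (i ℕ.* 60 ℕ.+ r)) 60
      ≈⟨ *-congʳ (classes-block S periodic i) ⟩
    product (G i) 60 * product (λ r → F (i ℕ.* 60 ℕ.+ r)) 60
      ≈⟨ product-* (G i) (λ r → F (i ℕ.* 60 ℕ.+ r)) 60 ⟨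
    product (λ r → G i r * F (i ℕ.* 60 ℕ.+ r)) 60
      ≈⟨ product-cong 60 step ⟩
    product (G (suc i)) 60 ∎
    where
    F : ℕ → Carrier
    F j = factor S (suc j)
    G : ℕ → ℕ → Carrier
    G i r = if S (suc r) then poch (- 1# * q ^ suc r) (q ^ 60) i else 1#
    exponent : ∀ r → q ^ suc (i ℕ.* 60 ℕ.+ r) ≈ q ^ suc r * (q ^ 60) ^ i
    exponent r = begin
      q ^ suc (i ℕ.* 60 ℕ.+ r)         ≡⟨ ≡.cong (λ m → q ^ suc m) (≡.trans (ℕ.+-comm (i ℕ.* 60) r) (≡.cong (r ℕ.+_) (ℕ.*-comm i 60))) ⟩
      q ^ (suc r ℕ.+ 60 ℕ.* i)         ≈⟨ ^-homo-* q (suc r) (60 ℕ.* i) ⟩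
      q ^ suc r * q ^ (60 ℕ.* i)       ≈⟨ *-congˡ (^-assocʳ q 60 i) ⟨
      q ^ suc r * (q ^ 60) ^ i         ∎
    step : ∀ r → G i r * F (i ℕ.* 60 ℕ.+ r) ≈ G (suc i) r
    step r rewrite periodic i r with S (suc r)
    ... | true  = *-congˡ (+-congˡ (trans (*-congˡ (exponent r)) (sym (*-assoc _ _ _))))
    ... | false = *-identityˡ 1#

  product-classes : ∀ S m → product (λ r → if S (suc r) then φ (suc r) else 1#) m ≈ ev (classes S m)
  product-classes S zero    = refl
  product-classes S (suc m) with S (suc m)
  ... | true  = trans (*-comm _ _) (*-congˡ (product-classes S m))
  ... | false = trans (*-identityʳ _) (product-classes S m)

  denominator-classes : ∀ S → Periodic S → denominator S (L ℕ.* 60) ≈ ev (classes S 60)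
  denominator-classes S periodic = trans (classes-block S periodic L) (product-classes S 60)

  ϑ : List (Sign × ℕ) → Carrier
  ϑ []             = 1#
  ϑ ((σ , e) ∷ es) = θ σ e * ϑ es

  θ⁺ : ∀ e → θ Sign.+ e ≈ ev (doubled e)
  θ⁺ e = trans (*-cong (half⁺ e) (half⁺ (30 ℕ.∸ e)))
    (solve 4 (λ x y z w → x :* y :* (z :* w) := x :* (y :* (z :* (w :* con 1)))) refl _ _ _ _)

  -- `ev (doubled e)` is the theta product with sign +, and `half⁻` merges it with the one of sign
  -- -, once at `e` and once at `30 − e`.
  θ⁻ : ∀ e → θ Sign.- e * ev (doubled e) ≈ ev (e ℕ.+ e ∷ (30 ℕ.∸ e) ℕ.+ (30 ℕ.∸ e) ∷ [])
  θ⁻ e = begin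
    θ Sign.- e * ev (doubled e)
      ≈⟨ *-congˡ (sym (θ⁺ e)) ⟩
    x * y * (z * w)
      ≈⟨ solve 4 (λ x y z w → x :* y :* (z :* w) := x :* z :* (y :* w :* con 1)) refl x y z w ⟩
    x * z * (y * w * 1#)
      ≈⟨ *-cong (half⁻ e) (*-congʳ (half⁻ (30 ℕ.∸ e))) ⟩
    φ (e ℕ.+ e) * (φ ((30 ℕ.∸ e) ℕ.+ (30 ℕ.∸ e)) * 1#) ∎
    where
    x = poch (1# * q ^ e) (q ^ 30) cutoff
    y = poch (1# * q ^ (30 ℕ.∸ e)) (q ^ 30) cutoff
    z = poch (- 1# * q ^ e) (q ^ 30) cutoff
    w = poch (- 1# * q ^ (30 ℕ.∸ e)) (q ^ 30) cutoff

  ϑ-residues : ∀ es → ϑ es * ev (denominators es) ≈ ev (numerators es)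
  ϑ-residues []                    = *-identityˡ 1#
  ϑ-residues ((Sign.+ , e) ∷ es) = begin
    θ Sign.+ e * ϑ es * ev (denominators es)
      ≈⟨ trans (*-assoc _ _ _) (*-cong (θ⁺ e) (ϑ-residues es)) ⟩
    ev (doubled e) * ev (numerators es)
      ≈⟨ ev-++ (doubled e) (numerators es) ⟨
    ev (doubled e ++ numerators es) ∎
  ϑ-residues ((Sign.- , e) ∷ es) = begin
    θ Sign.- e * ϑ es * ev (doubled e ++ denominators es)
      ≈⟨ *-congˡ (ev-++ (doubled e) (denominators es)) ⟩
    θ Sign.- e * ϑ es * (ev (doubled e) * ev (denominators es))
      ≈⟨ solve 4 (λ x y z w → x :* y :* (z :* w) := x :* z :* (y :* w)) refl _ _ _ _ ⟩
    θ Sign.- e * ev (doubled e) * (ϑ es * ev (denominators es))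
      ≈⟨ *-cong (θ⁻ e) (ϑ-residues es) ⟩
    ev (e ℕ.+ e ∷ (30 ℕ.∸ e) ℕ.+ (30 ℕ.∸ e) ∷ []) * ev (numerators es)
      ≈⟨ ev-++ (e ℕ.+ e ∷ (30 ℕ.∸ e) ℕ.+ (30 ℕ.∸ e) ∷ []) (numerators es) ⟨
    ev (e ℕ.+ e ∷ (30 ℕ.∸ e) ℕ.+ (30 ℕ.∸ e) ∷ numerators es) ∎

  -- Over the common denominator `dX * dY * dZ` the relation involves only genuine products of `φ`.
  -- The balances then make `ev y` a common factor, a unit because its residues are positive.
  residue-identity : ∀ s X Y Z S T → ϑ Y ≈ q ^ s * ϑ X + ϑ Z → Certificate X Y Z S T →
                     ev T ≈ q ^ s * ev S + ev S * ev T
  residue-identity s X Y Z S T relation cert = invertible-cancel (ev-invertible (toWitness (positive cert))) (begin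
    ev y * ev T
      ≈⟨ *-congʳ y≈ ⟩
    (q ^ s * ev x + ev z) * ev T
      ≈⟨ solve 4 (λ a x z t → (a :* x :+ z) :* t := a :* (x :* t) :+ z :* t) refl _ _ _ _ ⟩
    q ^ s * (ev x * ev T) + ev z * ev T
      ≈⟨ +-cong (*-congˡ (trans (sym (ev-++ x T)) (trans (ev-sort {x ++ T} {y ++ S} (balance₁ cert)) (ev-++ y S))))
                (*-congʳ (trans (ev-sort {z} {y ++ S} (balance₂ cert)) (ev-++ y S))) ⟩
    q ^ s * (ev y * ev S) + ev y * ev S * ev T
      ≈⟨ solve 4 (λ a y s t → a :* (y :* s) :+ y :* s :* t := y :* (a :* s :+ s :* t)) refl _ _ _ _ ⟩
    ev y * (q ^ s * ev S + ev S * ev T) ∎)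
    where
    x = cleared X Y Z
    y = cleared Y X Z
    z = cleared Z X Y
    dX = ev (denominators X)
    dY = ev (denominators Y)
    dZ = ev (denominators Z)
    expand : ∀ A B C → ev (cleared A B C) ≈ ϑ A * (ev (denominators A) * (ev (denominators B) * ev (denominators C)))
    expand A B C = begin
      ev (numerators A ++ denominators B ++ denominators C)
        ≈⟨ trans (ev-++ (numerators A) _) (*-congˡ (ev-++ (denominators B) (denominators C))) ⟩
      ev (numerators A) * (ev (denominators B) * ev (denominators C))
        ≈⟨ *-congʳ (sym (ϑ-residues A)) ⟩
      ϑ A * ev (denominators A) * (ev (denominators B) * ev (denominators C))
        ≈⟨ *-assoc _ _ _ ⟩
      ϑ A * (ev (denominators A) * (ev (denominators B) * ev (denominators C))) ∎
    y≈ : ev y ≈ q ^ s * ev x + ev z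
    y≈ = begin
      ev y
        ≈⟨ expand Y X Z ⟩
      ϑ Y * (dY * (dX * dZ))
        ≈⟨ *-congʳ relation ⟩
      (q ^ s * ϑ X + ϑ Z) * (dY * (dX * dZ))
        ≈⟨ solve 6 (λ a x z u v w → (a :* x :+ z) :* (v :* (u :* w)) := a :* (x :* (u :* (v :* w))) :+ z :* (w :* (u :* v)))
             refl (q ^ s) (ϑ X) (ϑ Z) dX dY dZ ⟩
      q ^ s * (ϑ X * (dX * (dY * dZ))) + ϑ Z * (dZ * (dX * dY))
        ≈⟨ +-cong (*-congˡ (expand X Y Z)) (expand Z X Y) ⟨
      q ^ s * ev x + ev z ∎

  module _ (σa σb σc σd : Sign) {a b c d : ℕ} (1≤d : 1 ℕ.≤ d) (d<c : d ℕ.< c) (c<b : c ℕ.< b) (b<a : b ℕ.< a) (a<15 : a ℕ.+ a ℕ.< 30) where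
    private
      X = pairing σa σb σc σd a b c d
      Y = pairing σa σc σb σd a c b d
      Z = pairing σa σd σb σc a d b c

      ϑ-pairing : ∀ σa σb σc σd a b c d →
        θ² (σa Sign.* σb) a b * θ² (σc Sign.* σd) c d ≈ ϑ (pairing σa σb σc σd a b c d)
      ϑ-pairing σa σb σc σd a b c d = solve 4 (λ x y z w → x :* y :* (z :* w) := x :* (y :* (z :* (w :* con 1)))) refl _ _ _ _

      relation : ⟦ σb Sign.* σc ⟧ * q ^ (b ℕ.∸ c) * ϑ X + ϑ Z ≈ ϑ Y
      relation = begin
        ⟦ σb Sign.* σc ⟧ * q ^ (b ℕ.∸ c) * ϑ X + ϑ Z
          ≈⟨ +-cong (*-congˡ (ϑ-pairing σa σb σc σd a b c d)) (ϑ-pairing σa σd σb σc a d b c) ⟨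
        _
          ≈⟨ weierstrass σa σb σc σd 1≤d d<c c<b b<a a<15 ⟩
        _
          ≈⟨ ϑ-pairing σa σc σb σd a c b d ⟩
        ϑ Y ∎

    relation⁺ : σb Sign.* σc ≡ Sign.+ → ϑ Y ≈ q ^ (b ℕ.∸ c) * ϑ X + ϑ Z
    relation⁺ eq = begin
      ϑ Y                                           ≈⟨ relation ⟨
      ⟦ σb Sign.* σc ⟧ * q ^ (b ℕ.∸ c) * ϑ X + ϑ Z  ≡⟨ ≡.cong (λ σ → ⟦ σ ⟧ * q ^ (b ℕ.∸ c) * ϑ X + ϑ Z) eq ⟩
      1# * q ^ (b ℕ.∸ c) * ϑ X + ϑ Z                ≈⟨ +-congʳ (*-congʳ (*-identityˡ _)) ⟩
      q ^ (b ℕ.∸ c) * ϑ X + ϑ Z                     ∎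

    -- With a negative ratio of the middle points the `X` term changes sides, so `Y` and `Z`
    -- exchange their roles.
    relation⁻ : σb Sign.* σc ≡ Sign.- → ϑ Z ≈ q ^ (b ℕ.∸ c) * ϑ X + ϑ Y
    relation⁻ eq = begin
      ϑ Z
        ≈⟨ trans (+-congʳ (trans (*-congʳ (-‿inverseʳ 1#)) (zeroˡ _))) (+-identityˡ _) ⟨
      (1# + - 1#) * (q ^ (b ℕ.∸ c) * ϑ X) + ϑ Z
        ≈⟨ solve 4 (λ m y x z → (con 1 :+ m) :* (y :* x) :+ z := y :* x :+ (m :* y :* x :+ z)) refl (- 1#) (q ^ (b ℕ.∸ c)) (ϑ X) (ϑ Z) ⟩
      q ^ (b ℕ.∸ c) * ϑ X + (- 1# * q ^ (b ℕ.∸ c) * ϑ X + ϑ Z)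
        ≈⟨ +-congˡ (trans (reflexive (≡.cong (λ σ → ⟦ σ ⟧ * q ^ (b ℕ.∸ c) * ϑ X + ϑ Z) (≡.sym eq))) relation) ⟩
      q ^ (b ℕ.∸ c) * ϑ X + ϑ Y ∎

-- Comparing coefficients and the four identities

module _ (n : ℕ) where
  private
    -- Coefficients with index below `K` are compared, so `suc n` just includes the coefficient at
    -- `n`.
    K = suc n
  open PowerSeries
  open Truncated K
  open CommutativeRing ring hiding (zero; ring)
  open ResidueProducts ring K qₛ q^K≈0 K ℕ.≤-refl
  open PartitionCounting
  open NaturalSolver commutativeSemiring using (solve; _:+_; _:*_; _:=_)
  open EulerProduct ring qₛ using (denominator)
  open SetoidReasoning setoid

  -- Division by `D S * D T` is multiplication by the two generating functions. The resulting
  -- summand `1#` affects only the coefficient at 0, and `n ≥ s ≥ 1`.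
  shifted : ∀ {s X Y Z S T} → 1 ℕ.≤ s → s ℕ.≤ n → Periodic S → Periodic T →
    Certificate X Y Z (classes S 60) (classes T 60) → ϑ Y ≈ qₛ ^ s * ϑ X + ϑ Z →
    p S n ≡ p T (n ℕ.∸ s)
  shifted {s} {X} {Y} {Z} {S} {T} 1≤s s≤n periodicS periodicT cert relation = ℤ.+-injective (≡R.begin
    + p S n                              ≡R.≡⟨ ≡.cong +_ (p≡restricted S n≤N) ⟩
    C S n                                ≡R.≡⟨ coefficient shifted-series n ℕ.≤-refl ⟩
    (qₛ ^ s * C T) n ℤ.+ 1ₛ n            ≡R.≡⟨ ≡.cong₂ ℤ._+_ (≡.cong (qₛ ^ s * C T) (≡.sym (ℕ.m+[n∸m]≡n s≤n))) (1ₛ-vanish (ℕ.≤-trans 1≤s s≤n)) ⟩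
    (qₛ ^ s * C T) (s ℕ.+ (n ℕ.∸ s)) ℤ.+ + 0  ≡R.≡⟨ ℤ.+-identityʳ _ ⟩
    (qₛ ^ s * C T) (s ℕ.+ (n ℕ.∸ s))     ≡R.≡⟨ q^⊛-+ s (C T) (n ℕ.∸ s) ⟩
    C T (n ℕ.∸ s)                        ≡R.≡⟨ ≡.cong +_ (p≡restricted T (ℕ.≤-trans (ℕ.m∸n≤m n s) n≤N)) ⟨
    + p T (n ℕ.∸ s)                      ≡R.∎)
    where
    module ≡R = ≡.≡-Reasoning
    -- A whole number of blocks of 60, as the regrouping by residue classes requires, and large
    -- enough that bounding the parts by `N` excludes no partition of `n`.
    N = K ℕ.* 60
    n≤N : n ℕ.≤ N
    n≤N = ℕ.≤-trans (ℕ.n≤1+n n) (ℕ.m≤m*n K 60)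
    C : PosSet → Series
    C U = generating K U N
    D : PosSet → Series
    D U = denominator U N
    1ₛ-vanish : ∀ {n} → 1 ℕ.≤ n → 1ₛ n ≡ + 0
    1ₛ-vanish (s≤s _) = ≡.refl
    CD : ∀ U → C U * D U ≈ 1#
    CD U = generating-denominator K U N
    identity : D T ≈ qₛ ^ s * D S + D S * D T
    identity = begin
      D T
        ≈⟨ denominator-classes T periodicT ⟩
      ev (classes T 60)
        ≈⟨ residue-identity s X Y Z (classes S 60) (classes T 60) relation cert ⟩
      qₛ ^ s * ev (classes S 60) + ev (classes S 60) * ev (classes T 60)
        ≈⟨ +-cong (*-cong (refl {qₛ ^ s}) (denominator-classes S periodicS)) (*-cong (denominator-classes S periodicS) (denominator-classes T periodicT)) ⟨
      qₛ ^ s * D S + D S * D T ∎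
    shifted-series : C S ≈ qₛ ^ s * C T + 1#
    shifted-series = begin
      C S
        ≈⟨ *-identityʳ (C S) ⟨
      C S * 1#
        ≈⟨ *-cong (refl {C S}) (CD T) ⟨
      C S * (C T * D T)
        ≈⟨ *-cong (refl {C S}) (*-cong (refl {C T}) identity) ⟩
      C S * (C T * (qₛ ^ s * D S + D S * D T))
        ≈⟨ solve 5 (λ cs ct x ds dt → cs :* (ct :* (x :* ds :+ ds :* dt)) := x :* ct :* (cs :* ds) :+ cs :* ds :* (ct :* dt))
             refl (C S) (C T) (qₛ ^ s) (D S) (D T) ⟩
      qₛ ^ s * C T * (C S * D S) + C S * D S * (C T * D T)
        ≈⟨ +-cong (*-cong (refl {qₛ ^ s * C T}) (CD S)) (*-cong (CD S) (CD T)) ⟩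
      qₛ ^ s * C T * 1# + 1# * 1#
        ≈⟨ +-cong (*-identityʳ (qₛ ^ s * C T)) (*-identityˡ 1#) ⟩
      qₛ ^ s * C T + 1# ∎

  module _ {a b c d : ℕ} {1≤d : True (1 ℕ.≤? d)} {d<c : True (d ℕ.<? c)} {c<b : True (c ℕ.<? b)} {b<a : True (b ℕ.<? a)}
    {2a<30 : True (a ℕ.+ a ℕ.<? 30)} (b∸c≤n : b ℕ.∸ c ℕ.≤ n) {rs ts : List ℕ} where
    private
      0<b∸c : 1 ℕ.≤ b ℕ.∸ c
      0<b∸c = ℕ.m<n⇒0<n∸m (toWitness c<b)

    shifted⁺ : ∀ σa σb σc σd → σb Sign.* σc ≡ Sign.+ →
      Certificate (pairing σa σb σc σd a b c d) (pairing σa σc σb σd a c b d) (pairing σa σd σb σc a d b c)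
        (classes (pmSet 60 rs) 60) (classes (pmSet 60 ts) 60) →
      p (pmSet 60 rs) n ≡ p (pmSet 60 ts) (n ℕ.∸ (b ℕ.∸ c))
    shifted⁺ σa σb σc σd eq cert = shifted 0<b∸c b∸c≤n (pmSet-periodic rs) (pmSet-periodic ts) cert
      (relation⁺ σa σb σc σd (toWitness 1≤d) (toWitness d<c) (toWitness c<b) (toWitness b<a) (toWitness 2a<30) eq)

    shifted⁻ : ∀ σa σb σc σd → σb Sign.* σc ≡ Sign.- →
      Certificate (pairing σa σb σc σd a b c d) (pairing σa σd σb σc a d b c) (pairing σa σc σb σd a c b d)
        (classes (pmSet 60 rs) 60) (classes (pmSet 60 ts) 60) →
      p (pmSet 60 rs) n ≡ p (pmSet 60 ts) (n ℕ.∸ (b ℕ.∸ c))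
    shifted⁻ σa σb σc σd eq cert = shifted 0<b∸c b∸c≤n (pmSet-periodic rs) (pmSet-periodic ts) cert
      (relation⁻ σa σb σc σd (toWitness 1≤d) (toWitness d<c) (toWitness c<b) (toWitness b<a) (toWitness 2a<30) eq)

theorem12p1 : (∀ (n : ℕ) → n ≥ 1 →
    p (pmSet 60 (1 ∷ 3 ∷ 4 ∷ 5 ∷ 7 ∷ 22 ∷ 23 ∷ 24 ∷ 25 ∷ 26 ∷ 27 ∷ 29 ∷ [])) n
    ≡ p (pmSet 60 (1 ∷ 2 ∷ 3 ∷ 7 ∷ 11 ∷ 19 ∷ 23 ∷ 24 ∷ 26 ∷ 27 ∷ 28 ∷ 29 ∷ [])) (n ∸ 1))
    × (∀ (n : ℕ) → n ≥ 2 →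
    p (pmSet 60 (2 ∷ 7 ∷ 9 ∷ 11 ∷ 12 ∷ 13 ∷ 14 ∷ 16 ∷ 17 ∷ 19 ∷ 21 ∷ 23 ∷ [])) n
    ≡ p (pmSet 60 (2 ∷ 5 ∷ 7 ∷ 9 ∷ 11 ∷ 12 ∷ 19 ∷ 21 ∷ 23 ∷ 25 ∷ 26 ∷ 28 ∷ [])) (n ∸ 2))
    × (∀ (n : ℕ) → n ≥ 2 →
    p (pmSet 60 (2 ∷ 3 ∷ 5 ∷ 11 ∷ 13 ∷ 14 ∷ 16 ∷ 17 ∷ 19 ∷ 24 ∷ 25 ∷ 27 ∷ [])) n
    ≡ p (pmSet 60 (1 ∷ 3 ∷ 8 ∷ 11 ∷ 13 ∷ 14 ∷ 17 ∷ 19 ∷ 22 ∷ 24 ∷ 27 ∷ 29 ∷ [])) (n ∸ 2))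
    × (∀ (n : ℕ) → n ≥ 1 →
    p (pmSet 60 (1 ∷ 5 ∷ 8 ∷ 9 ∷ 12 ∷ 13 ∷ 14 ∷ 17 ∷ 21 ∷ 22 ∷ 25 ∷ 29 ∷ [])) n
    ≡ p (pmSet 60 (1 ∷ 4 ∷ 7 ∷ 9 ∷ 12 ∷ 13 ∷ 17 ∷ 21 ∷ 22 ∷ 23 ∷ 26 ∷ 29 ∷ [])) (n ∸ 1))
theorem12p1 =
    -- The shift is `b − c` in all four cases; the two `≡.refl` inside each certificate compare
    -- sorted residue lists by evaluation.
    (λ n 1≤n → shifted⁺ n {a = 7} {4} {3} {1} 1≤n Sign.+ Sign.- Sign.- Sign.+ ≡.refl (certificate ≡.refl ≡.refl _))
  -- Here `σb` and `σc` differ, so the product belonging to the pairs `a, d` and `b, c` is the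
  -- isolated one.
  , (λ n 2≤n → shifted⁻ n {a = 11} {9} {7} {2} 2≤n Sign.- Sign.+ Sign.- Sign.+ ≡.refl (certificate ≡.refl ≡.refl _))
  , (λ n 2≤n → shifted⁺ n {a = 12} {4} {2} {1} 2≤n Sign.+ Sign.- Sign.- Sign.+ ≡.refl (certificate ≡.refl ≡.refl _))
  , (λ n 1≤n → shifted⁺ n {a = 13} {9} {8} {1} 1≤n Sign.+ Sign.- Sign.- Sign.+ ≡.refl (certificate ≡.refl ≡.refl _))
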